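{- Let $G \in \widetilde{\mathbb{G}}$. Put $M:=\max_{G^L}\{\rho_0(G^L)\}$ and $m:=\min_{G^R}\{\lambda_0(G^R)\}$, with the conventions $\max\emptyset=-\infty$ and $\min\emptyset=+\infty$. Consider the following conditions on a Left option $G^L$ or a Right option $G^R$ of $G$: (i) $M\in\mathbb{Z}$, and $G^L$ is equal to $M$. (ii) $M\in\mathbb{Z}$, and $G^L$ satisfies $\rho_0(G^L)=M$ although $G^L$ is not equal to an integer; furthermore, $s\mapsto\widetilde{\rho}_s(G^L)$ has slope $0$ on $s\in(-\delta,0]$, where $\delta$ is a sufficiently small positive number such that the slope is uniquely determined. (iii) $m\in\mathbb{Z}$, and $G^R$ is equal to $m$. (iv) $m\in\mathbb{Z}$, and $G^R$ satisfies $\lambda_0(G^R)=m$ although $G^R$ is not equal to an integer; furthermore, $s\mapsto\widetilde{\lambda}_s(G^R)$ has slope $0$ on $s\in(-\delta,0]$, where $\delta$ is a sufficiently small positive number such that the slope is uniquely determined. Let $l:=M+1$ if there exists a $G^L$ satisfying (i) or (ii), and $l:=M$ otherwise. Let $r:=m-1$ if there exists a $G^R$ satisfying (iii) or (iv), and $r:=m$ otherwise. Let $$S:=\{n\in\mathbb{Z}\mid l\le n\le r\}.$$ Then: 1. If $S=\emptyset$, then $G$ is not equal to an integer. 2. Otherwise, $G$ is equal to the (unique) $n\in S$ whose absolute value attains the minimum of $\{|k| \mid k\in S\}$.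
   Context: Games. $\widetilde{\mathbb{G}}$ is the set of all formal (short, i.e. finite loopfree) normal-play partizan games $G=\{G^L\mid G^R\}$, where $G^L$ (resp. $G^R$) ranges over the finitely many Left (resp. Right) options of $G$; $\tilde b(G)$ is the formal birthday (height of the game tree). Sums and negatives of games are the usual ones; $G\ge 0$ means Left wins $G$ moving second under normal play, $G\ge H$ means $G-H\ge 0$, and $G$ is equal to $H$ (equality of game values) if $G\ge H$ and $H\ge G$. The dyadic rationals $\mathbb{Z}[\frac12]$ are identified in the usual way with the numbers among game values; "equal to an integer/number" means having such a game value. When a dyadic rational is used as a formal game, its canonical form is meant. Cooling and temperature. For $G\in\widetilde{\mathbb{G}}$ and $t\in\mathbb{Z}[\frac12]$, define $\lambda_t(G),\rho_t(G)\in\mathbb{Z}[\frac12]$, $G_t\in\widetilde{\mathbb{G}}$ and $t(G)\in\mathbb{Z}[\frac12]\cup\{ -\infty\}$ by recursion on $\tilde b(G)$ (this recursion is well-defined): - If $G$ is equal to an integer $n$: $\lambda_t(G)=\rho_t(G)=n$, $G_t=n$ (canonical form), $t(G)=-\infty$. - Otherwise let $\widetilde{\lambda}_t(G)=\max_{G^L}\{\rho_t(G^L)-t\}$, $\widetilde{\rho}_t(G)=\min_{G^R}\{\lambda_t(G^R)+t\}$, $\widetilde{G}_t=\{(G^L)_t-t\mid (G^R)_t+t\}$ (with all $G^L$, $G^R$), and $t(G)=\min\{t\in\mathbb{Z}[\frac12]\mid \widetilde{\lambda}_t(G)=\widetilde{\rho}_t(G)\}$. If $t\le t(G)$, set $\lambda_t(G)=\widetilde{\lambda}_t(G)$,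 $\rho_t(G)=\widetilde{\rho}_t(G)$, $G_t=\widetilde{G}_t$. If $t>t(G)$, set $\lambda_t(G)=\rho_t(G)=x$ and $G_t=x$ (canonical form), where $x=\lambda_{t(G)}(G)=\rho_{t(G)}(G)$. For $G$ not equal to an integer, $\widetilde{\lambda}_t(G)$ and $\widetilde{\rho}_t(G)$ are continuous piecewise linear functions of $t\in\mathbb{Z}[\frac12]$ with finitely many pieces, with slopes in $\{0,-1\}$ and $\{0,1\}$ respectively, so the slope on $(-\delta,0]$ is well-defined for all sufficiently small $\delta>0$. -}

module Defs where

import Algebra
import Algebra.Properties.CommutativeSemigroup
open import Data.Bool using (if_then_else_)
open import Data.Empty using (⊥; ⊥-elim)
open import Data.Fin using (Fin; zero; suc; _↑ˡ_; _↑ʳ_; splitAt)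
open import Data.Fin.Properties using (any?; all?)
open import Data.Integer as ℤ using (ℤ; +_; -[1+_]; 0ℤ; 1ℤ; -1ℤ)
import Data.Integer.Properties as ℤ
open import Data.Integer.Tactic.RingSolver using (solve-∀)
open import Data.Nat as ℕ using (ℕ; zero; suc)
import Data.Nat.Properties as ℕ
open import Data.Product using (∃; ∃₂; _×_; _,_; proj₁; proj₂)
open import Data.Rational as ℚ using (ℚ; _/_; 0ℚ)
import Data.Rational.Literals as ℚ
import Data.Rational.Properties as ℚ
import Data.Rational.Unnormalised as ℚᵘ
import Data.Rational.Unnormalised.Properties as ℚᵘ
open import Data.Sum as Sum using (_⊎_; inj₁; inj₂; [_,_]′)
open import Data.Vec as Vec using (Vec)
open import Data.Vec.Functional using (Vector; []; _++_)
open import Data.Vec.Functional.Properties using (lookup-++ˡ; lookup-++ʳ)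
open import Function using (_∘_)
open import Relation.Binary.Bundles using (TotalOrder)
import Relation.Binary.Construct.Add.Extrema.NonStrict as Extrema
open import Relation.Binary.PropositionalEquality hiding ([_])
import Relation.Binary.Reflection as Reflection
open import Relation.Nullary using (¬_; Dec; yes; no; does; contradiction)
import Relation.Nullary.Construct.Add.Infimum as Infimum
open import Relation.Nullary.Construct.Add.Infimum using (_₋; ⊥₋)
open import Relation.Nullary.Construct.Add.Extrema using (_±; ⊥±; ⊤±; [_])
import Relation.Nullary.Decidable as Dec
open import Relation.Nullary.Decidable using (_×-dec_; _⊎-dec_; ¬?)
open import Relation.Unary using (Pred)

------------------------------------------------------------------------
-- Games

infixl 6 _⊕_ _⊖_
infix 8 ⊝_
infix 4 _≥ᴳ_ _≤ᴳ_ _≈ᴳ_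

data Game : Set where
  ⟨_∣_⟩ : ∀ {m n} → Vector Game m → Vector Game n → Game

#ᴸ #ᴿ : Game → ℕ
#ᴸ (⟨_∣_⟩ {m} _ _)     = m
#ᴿ (⟨_∣_⟩ {_} {n} _ _) = n

left : (G : Game) → Vector Game (#ᴸ G)
left ⟨ L ∣ R ⟩ = L

right : (G : Game) → Vector Game (#ᴿ G)
right ⟨ L ∣ R ⟩ = R

⊝_ : Game → Game
⊝ ⟨ L ∣ R ⟩ = ⟨ (λ j → ⊝ R j) ∣ (λ i → ⊝ L i) ⟩

_⊕_ : Game → Game → Game
G@(⟨ L ∣ R ⟩) ⊕ H@(⟨ L′ ∣ R′ ⟩) =
  ⟨ (λ i → L i ⊕ H) ++ (λ i → G ⊕ L′ i) ∣ (λ j → R j ⊕ H) ++ (λ j → G ⊕ R′ j) ⟩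

_⊖_ : Game → Game → Game
G ⊖ H = G ⊕ (⊝ H)

LeftWinsFirst LeftWinsSecond : Game → Set
LeftWinsFirst  ⟨ L ∣ R ⟩ = ∃ λ i → LeftWinsSecond (L i)
LeftWinsSecond ⟨ L ∣ R ⟩ = ∀ j → LeftWinsFirst (R j)

_≥ᴳ_ _≤ᴳ_ _≈ᴳ_ : Game → Game → Set
G ≥ᴳ H = LeftWinsSecond (G ⊖ H)
G ≤ᴳ H = H ≥ᴳ G
G ≈ᴳ H = G ≥ᴳ H × H ≥ᴳ G

integer : ℤ → Game
integer (+ zero)     = ⟨ [] ∣ [] ⟩
integer (+ suc n)    = ⟨ (λ (_ : Fin 1) → integer (+ n)) ∣ [] ⟩
integer -[1+ zero ]  = ⟨ [] ∣ (λ (_ : Fin 1) → integer (+ zero)) ⟩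
integer -[1+ suc n ] = ⟨ [] ∣ (λ (_ : Fin 1) → integer -[1+ n ]) ⟩

IsInteger : Game → Set
IsInteger G = ∃ λ n → G ≈ᴳ integer n

------------------------------------------------------------------------
-- Dyadic rationals

module Fractions where
  /≃ : ∀ i m → .{{_ : ℕ.NonZero m}} → ℚ.toℚᵘ (i / m) ℚᵘ.≃ (i ℚᵘ./ m)
  /≃ i (suc m) = ℚ.toℚᵘ-fromℚᵘ (ℚᵘ.mkℚᵘ i m)

  /-+-/ : ∀ i j m n → .{{_ : ℕ.NonZero m}} .{{_ : ℕ.NonZero n}} .{{_ : ℕ.NonZero (m ℕ.* n)}} →
    i / m ℚ.+ j / n ≡ (i ℤ.* + n ℤ.+ j ℤ.* + m) / (m ℕ.* n)
  /-+-/ i j m@(suc _) n@(suc _) = ℚ.toℚᵘ-injective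
    (ℚᵘ.≃-trans (ℚ.toℚᵘ-homo-+ (i / m) (j / n))
    (ℚᵘ.≃-trans (ℚᵘ.+-cong (/≃ i m) (/≃ j n))
                (ℚᵘ.≃-sym (/≃ (i ℤ.* + n ℤ.+ j ℤ.* + m) (m ℕ.* n)))))

  neg-/ : ∀ i m → .{{_ : ℕ.NonZero m}} → ℚ.- (i / m) ≡ (ℤ.- i) / m
  neg-/ i m@(suc _) = ℚ.toℚᵘ-injective
    (ℚᵘ.≃-trans (ℚ.toℚᵘ-homo‿- (i / m))
    (ℚᵘ.≃-trans (ℚᵘ.-‿cong (/≃ i m)) (ℚᵘ.≃-sym (/≃ (ℤ.- i) m))))

  /-≡ : ∀ i j m n → .{{_ : ℕ.NonZero m}} .{{_ : ℕ.NonZero n}} →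
    i ℤ.* + n ≡ j ℤ.* + m → i / m ≡ j / n
  /-≡ i j m@(suc _) n@(suc _) h = ℚ.toℚᵘ-injective
    (ℚᵘ.≃-trans (/≃ i m) (ℚᵘ.≃-trans (ℚᵘ.*≡* h) (ℚᵘ.≃-sym (/≃ j n))))

  /-≤ : ∀ i j m n → .{{_ : ℕ.NonZero m}} .{{_ : ℕ.NonZero n}} →
    i ℤ.* + n ℤ.≤ j ℤ.* + m → i / m ℚ.≤ j / n
  /-≤ i j m@(suc _) n@(suc _) h = ℚ.toℚᵘ-cancel-≤
    (ℚᵘ.≤-respˡ-≃ (ℚᵘ.≃-sym (/≃ i m)) (ℚᵘ.≤-respʳ-≃ (ℚᵘ.≃-sym (/≃ j n)) (ℚᵘ.*≤* h)))

  /-≤⁻ : ∀ i j m n → .{{_ : ℕ.NonZero m}} .{{_ : ℕ.NonZero n}} →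
    i / m ℚ.≤ j / n → i ℤ.* + n ℤ.≤ j ℤ.* + m
  /-≤⁻ i j m@(suc _) n@(suc _) h = ℚᵘ.drop-*≤*
    (ℚᵘ.≤-respˡ-≃ (/≃ i m) (ℚᵘ.≤-respʳ-≃ (/≃ j n) (ℚ.toℚᵘ-mono-≤ h)))

open Fractions public

infixl 7 _/2^_

_/2^_ : ℤ → ℕ → ℚ
i /2^ k = _/_ i (2 ℕ.^ k) {{ℕ.m^n≢0 2 k}}

IsDyadic : ℚ → Set
IsDyadic q = ∃₂ λ i k → q ≡ i /2^ k

record 𝔻 : Set where
  constructor mk𝔻
  field
    value     : ℚ
    .isDyadic : IsDyadic value
open 𝔻 public

+-dyadic : ∀ {p q} → IsDyadic p → IsDyadic q → IsDyadic (p ℚ.+ q)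
+-dyadic (i , k , refl) (j , l , refl) = i ℤ.* + (2 ℕ.^ l) ℤ.+ j ℤ.* + (2 ℕ.^ k) , k ℕ.+ l ,
  trans (/-+-/ i j (2 ℕ.^ k) (2 ℕ.^ l) {{ℕ.m^n≢0 2 k}} {{ℕ.m^n≢0 2 l}} {{nz}})
    (ℚ./-cong {{nz}} {{ℕ.m^n≢0 2 (k ℕ.+ l)}} (refl {x = i ℤ.* + (2 ℕ.^ l) ℤ.+ j ℤ.* + (2 ℕ.^ k)}) (sym (ℕ.^-distribˡ-+-* 2 k l)))
  where
  nz = ℕ.m*n≢0 (2 ℕ.^ k) (2 ℕ.^ l) {{ℕ.m^n≢0 2 k}} {{ℕ.m^n≢0 2 l}}

neg-dyadic : ∀ {p} → IsDyadic p → IsDyadic (ℚ.- p)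
neg-dyadic (i , k , refl) = ℤ.- i , k , neg-/ i (2 ℕ.^ k) {{ℕ.m^n≢0 2 k}}

infixl 6 _+_ _-_
infix 8 -_
infix 4 _≤_ _<_

_+_ : 𝔻 → 𝔻 → 𝔻
mk𝔻 p a + mk𝔻 q b = mk𝔻 (p ℚ.+ q) (+-dyadic a b)

-_ : 𝔻 → 𝔻
- (mk𝔻 p a) = mk𝔻 (ℚ.- p) (neg-dyadic a)

_-_ : 𝔻 → 𝔻 → 𝔻
x - y = x + - y

fromℤ : ℤ → 𝔻
fromℤ n = mk𝔻 (n / 1) (n , 0 , refl)

0𝔻 : 𝔻
0𝔻 = fromℤ 0ℤ

data _≤_ (x y : 𝔻) : Set where
  *≤* : value x ℚ.≤ value y → x ≤ y

data _<_ (x y : 𝔻) : Set where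
  *<* : value x ℚ.< value y → x < y

drop-≤ : ∀ {x y} → x ≤ y → value x ℚ.≤ value y
drop-≤ (*≤* h) = h

value-injective : ∀ {x y} → value x ≡ value y → x ≡ y
value-injective refl = refl

≤-refl : ∀ {x} → x ≤ x
≤-refl = *≤* ℚ.≤-refl

≤-trans : ∀ {x y z} → x ≤ y → y ≤ z → x ≤ z
≤-trans (*≤* p) (*≤* q) = *≤* (ℚ.≤-trans p q)

≤-antisym : ∀ {x y} → x ≤ y → y ≤ x → x ≡ y
≤-antisym (*≤* p) (*≤* q) = value-injective (ℚ.≤-antisym p q)

abstract
  ≤-total : ∀ x y → x ≤ y ⊎ y ≤ x
  ≤-total x y = Sum.map *≤* *≤* (ℚ.≤-total (value x) (value y))

_≤?_ : ∀ x y → Dec (x ≤ y)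
x ≤? y = Dec.map′ *≤* drop-≤ (value x ℚ.≤? value y)

𝔻-totalOrder : TotalOrder _ _ _
𝔻-totalOrder = record
  { Carrier = 𝔻
  ; _≈_ = _≡_
  ; _≤_ = _≤_
  ; isTotalOrder = record
    { isPartialOrder = record
      { isPreorder = record { isEquivalence = isEquivalence ; reflexive = λ { refl → ≤-refl } ; trans = ≤-trans }
      ; antisym = ≤-antisym }
    ; total = ≤-total }
  }

import Algebra.Construct.NaturalChoice.Max 𝔻-totalOrder as Max
import Algebra.Construct.NaturalChoice.Min 𝔻-totalOrder as Min
open Max public using (_⊔_)
open Min public using (_⊓_)

------------------------------------------------------------------------
-- Cooling

maximum minimum : ∀ {n} → Vector 𝔻 (suc n) → 𝔻
maximum {zero}  v = v zero
maximum {suc n} v = v zero ⊔ maximum (v ∘ suc)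
minimum {zero}  v = v zero
minimum {suc n} v = v zero ⊓ minimum (v ∘ suc)

max min : ∀ {n} → Vector 𝔻 n → 𝔻 ±
max {zero}  v = ⊥±
max {suc n} v = [ maximum v ]
min {zero}  v = ⊤±
min {suc n} v = [ minimum v ]

module Tilde (λₜ ρₜ : 𝔻 → Game → 𝔻) where
  λ̃ₜ ρ̃ₜ : 𝔻 → Game → 𝔻 ±
  λ̃ₜ t G = max (λ i → ρₜ t (left G i) - t)
  ρ̃ₜ t G = min (λ j → λₜ t (right G j) + t)

record IsLeast (P : 𝔻 → Set) (τ : 𝔻) : Set where
  field
    holds : P τ
    least : ∀ s → P s → τ ≤ s

-- Maps solving the recursion that defines λₜ(G), ρₜ(G) and t(G) (⊥₋ is −∞).
-- The cooled games Gₜ are left out: the recursion for λₜ(G), ρₜ(G), t(G)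
-- refers to the options only through their λₜ and ρₜ.
record Cooling : Set where
  field
    λₜ ρₜ       : 𝔻 → Game → 𝔻
    temperature : Game → 𝔻 ₋
  open Tilde λₜ ρₜ public
  field
    integer-λ : ∀ {G n} t → G ≈ᴳ integer n → λₜ t G ≡ fromℤ n
    integer-ρ : ∀ {G n} t → G ≈ᴳ integer n → ρₜ t G ≡ fromℤ n
    integer-temperature : ∀ {G} → IsInteger G → temperature G ≡ ⊥₋
    noninteger-temperature : ∀ {G} → ¬ IsInteger G →
      ∃ λ τ → temperature G ≡ Infimum.[ τ ] × IsLeast (λ s → λ̃ₜ s G ≡ ρ̃ₜ s G) τ
    below-λ : ∀ {G t τ} → temperature G ≡ Infimum.[ τ ] → t ≤ τ → [ λₜ t G ] ≡ λ̃ₜ t G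
    below-ρ : ∀ {G t τ} → temperature G ≡ Infimum.[ τ ] → t ≤ τ → [ ρₜ t G ] ≡ ρ̃ₜ t G
    above-λ : ∀ {G t τ} → temperature G ≡ Infimum.[ τ ] → τ < t → λₜ t G ≡ λₜ τ G
    above-ρ : ∀ {G t τ} → temperature G ≡ Infimum.[ τ ] → τ < t → ρₜ t G ≡ ρₜ τ G

-- Slope 0 on (−δ , 0]; this passes to every smaller δ.
SlopeZeroBelow0 : {A : Set} → (𝔻 → A) → Set
SlopeZeroBelow0 f = ∃ λ δ → 0𝔻 < δ × (∀ s → - δ < s → s ≤ 0𝔻 → f s ≡ f 0𝔻)

------------------------------------------------------------------------
-- The order on games

++-all : ∀ {m n} {A : Set} (P : A → Set) (f : Vector A m) (g : Vector A n) →
  (∀ i → P (f i)) → (∀ j → P (g j)) → ∀ k → P ((f ++ g) k)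
++-all {m} P f g p q k with splitAt m k
... | inj₁ i = p i
... | inj₂ j = q j

++-allˡ : ∀ {m n} {A : Set} (P : A → Set) (f : Vector A m) (g : Vector A n) →
  (∀ k → P ((f ++ g) k)) → ∀ i → P (f i)
++-allˡ P f g p i = subst P (lookup-++ˡ f g i) (p (i ↑ˡ _))

++-allʳ : ∀ {m n} {A : Set} (P : A → Set) (f : Vector A m) (g : Vector A n) →
  (∀ k → P ((f ++ g) k)) → ∀ j → P (g j)
++-allʳ P f g p j = subst P (lookup-++ʳ f g j) (p (_ ↑ʳ j))

++-any : ∀ {m n} {A : Set} (P : A → Set) (f : Vector A m) (g : Vector A n) →
  ∃ (λ k → P ((f ++ g) k)) → ∃ (λ i → P (f i)) ⊎ ∃ (λ j → P (g j))
++-any {m} P f g (k , p) with splitAt m k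
... | inj₁ i = inj₁ (i , p)
... | inj₂ j = inj₂ (j , p)

++-anyˡ : ∀ {m n} {A : Set} (P : A → Set) (f : Vector A m) (g : Vector A n) →
  ∀ i → P (f i) → ∃ (λ k → P ((f ++ g) k))
++-anyˡ P f g i p = i ↑ˡ _ , subst P (sym (lookup-++ˡ f g i)) p

++-anyʳ : ∀ {m n} {A : Set} (P : A → Set) (f : Vector A m) (g : Vector A n) →
  ∀ j → P (g j) → ∃ (λ k → P ((f ++ g) k))
++-anyʳ P f g j p = _ ↑ʳ j , subst P (sym (lookup-++ʳ f g j)) p

lwf? : ∀ G → Dec (LeftWinsFirst G)
lws? : ∀ G → Dec (LeftWinsSecond G)
lwf? ⟨ L ∣ R ⟩ = any? λ i → lws? (L i)
lws? ⟨ L ∣ R ⟩ = all? λ j → lwf? (R j)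

_≤ᴳ?_ : ∀ G H → Dec (G ≤ᴳ H)
G ≤ᴳ? H = lws? (H ⊖ G)

-- Left wins moving first on H − G iff H ≤ G fails.
first⇒≰ : ∀ G H → LeftWinsFirst (H ⊖ G) → ¬ H ≤ᴳ G
≰⇒first : ∀ G H → ¬ H ≤ᴳ G → LeftWinsFirst (H ⊖ G)
first⇒≰ G@(⟨ L ∣ R ⟩) H@(⟨ L′ ∣ R′ ⟩) w h = [
  (λ (i , p) → first⇒≰ (L′ i) G (++-allʳ LeftWinsFirst (λ j → R j ⊖ H) (λ i → G ⊖ L′ i) h i) p) ,
  (λ (j , p) → first⇒≰ H (R j) (++-allˡ LeftWinsFirst (λ j → R j ⊖ H) (λ i → G ⊖ L′ i) h j) p) ]′
  (++-any LeftWinsSecond (λ i → L′ i ⊖ G) (λ j → H ⊖ R j) w)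
≰⇒first G@(⟨ L ∣ R ⟩) H@(⟨ L′ ∣ R′ ⟩) n = Dec.decidable-stable (lwf? (H ⊖ G)) λ ¬w →
  n (++-all LeftWinsFirst (λ j → R j ⊖ H) (λ i → G ⊖ L′ i)
    (λ j → ≰⇒first H (R j) λ p → ¬w (++-anyʳ LeftWinsSecond (λ i → L′ i ⊖ G) (λ j → H ⊖ R j) j p))
    (λ i → ≰⇒first (L′ i) G λ p → ¬w (++-anyˡ LeftWinsSecond (λ i → L′ i ⊖ G) (λ j → H ⊖ R j) i p)))

≤-intro : ∀ {G H} → (∀ i → ¬ H ≤ᴳ left G i) → (∀ j → ¬ right H j ≤ᴳ G) → G ≤ᴳ H
≤-intro {G@(⟨ L ∣ R ⟩)} {H@(⟨ L′ ∣ R′ ⟩)} p q =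
  ++-all LeftWinsFirst (λ j → R′ j ⊖ G) (λ i → H ⊖ L i)
    (λ j → ≰⇒first G (R′ j) (q j)) (λ i → ≰⇒first (L i) H (p i))

≤-left : ∀ {G H} → G ≤ᴳ H → ∀ i → ¬ H ≤ᴳ left G i
≤-left {G@(⟨ L ∣ R ⟩)} {H@(⟨ L′ ∣ R′ ⟩)} h i =
  first⇒≰ (L i) H (++-allʳ LeftWinsFirst (λ j → R′ j ⊖ G) (λ i → H ⊖ L i) h i)

≤-right : ∀ {G H} → G ≤ᴳ H → ∀ j → ¬ right H j ≤ᴳ G
≤-right {G@(⟨ L ∣ R ⟩)} {H@(⟨ L′ ∣ R′ ⟩)} h j =
  first⇒≰ G (R′ j) (++-allˡ LeftWinsFirst (λ j → R′ j ⊖ G) (λ i → H ⊖ L i) h j)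

≤ᴳ-refl : ∀ G → G ≤ᴳ G
≤ᴳ-refl G@(⟨ L ∣ R ⟩) = ≤-intro {G} {G}
  (λ i h → ≤-left h i (≤ᴳ-refl (L i)))
  (λ j h → ≤-right h j (≤ᴳ-refl (R j)))

≤ᴳ-trans : ∀ {G H K} → G ≤ᴳ H → H ≤ᴳ K → G ≤ᴳ K
≤ᴳ-trans {G@(⟨ L ∣ R ⟩)} {H@(⟨ L′ ∣ R′ ⟩)} {K@(⟨ L″ ∣ R″ ⟩)} p q = ≤-intro {G} {K}
  (λ i h → ≤-left p i (≤ᴳ-trans {H} {K} {L i} q h))
  (λ j h → ≤-right q j (≤ᴳ-trans {R″ j} {G} {H} h p))

left≱ : ∀ G i → ¬ G ≤ᴳ left G i
left≱ G = ≤-left (≤ᴳ-refl G)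

right≰ : ∀ G j → ¬ right G j ≤ᴳ G
right≰ G = ≤-right (≤ᴳ-refl G)

integer-< : ∀ n → ¬ integer (ℤ.suc n) ≤ᴳ integer n
integer-< (+ n)        = left≱ (integer (+ suc n)) zero
integer-< -[1+ zero ]  = right≰ (integer -[1+ zero ]) zero
integer-< -[1+ suc n ] = right≰ (integer -[1+ suc n ]) zero

integer-step : ∀ n → integer n ≤ᴳ integer (ℤ.suc n)
integer-step (+ zero) = ≤-intro {integer (+ 0)} {integer (+ 1)} (λ ()) (λ ())
integer-step (+ suc n) = ≤-intro {integer (+ suc n)} {integer (+ suc (suc n))}
  (λ _ h → integer-< (+ suc n) (≤ᴳ-trans {integer (+ suc (suc n))} {integer (+ n)} h (integer-step (+ n)))) (λ ())
integer-step -[1+ zero ] = ≤-intro {integer -[1+ 0 ]} {integer (+ 0)} (λ ()) (λ ())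
integer-step -[1+ suc zero ] = ≤-intro {integer -[1+ 1 ]} {integer -[1+ 0 ]} (λ ())
  (λ _ h → integer-< -[1+ 1 ] (≤ᴳ-trans {integer -[1+ 0 ]} {integer (+ 0)} (integer-step -[1+ 0 ]) h))
integer-step -[1+ suc (suc n) ] = ≤-intro {integer -[1+ 2 ℕ.+ n ]} {integer -[1+ suc n ]} (λ ())
  (λ _ h → integer-< -[1+ 2 ℕ.+ n ] (≤ᴳ-trans {integer -[1+ suc n ]} {integer -[1+ n ]} (integer-step -[1+ suc n ]) h))

private
  mono+ : ∀ k n → integer n ≤ᴳ integer (+ k ℤ.+ n)
  mono+ zero n = subst (λ x → integer n ≤ᴳ integer x) (sym (ℤ.+-identityˡ n)) (≤ᴳ-refl (integer n))
  mono+ (suc k) n = subst (λ x → integer n ≤ᴳ integer x) (sym (ℤ.+-assoc 1ℤ (+ k) n))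
    (≤ᴳ-trans {integer n} {integer (+ k ℤ.+ n)} (mono+ k n) (integer-step (+ k ℤ.+ n)))

  diff : ∀ {m n} → m ℤ.≤ n → ∃ λ k → n ≡ + k ℤ.+ m
  diff {m} {n} h = ℤ.∣ n ℤ.- m ∣ , (begin
      n                         ≡⟨ sym (ℤ.+-identityʳ n) ⟩
      n ℤ.+ 0ℤ                  ≡⟨ cong (λ x → n ℤ.+ x) (sym (ℤ.+-inverseˡ m)) ⟩
      n ℤ.+ (ℤ.- m ℤ.+ m)       ≡⟨ sym (ℤ.+-assoc n (ℤ.- m) m) ⟩
      n ℤ.- m ℤ.+ m             ≡⟨ cong (ℤ._+ m) (sym (ℤ.0≤i⇒+∣i∣≡i (ℤ.i≤j⇒0≤j-i h))) ⟩
      + ℤ.∣ n ℤ.- m ∣ ℤ.+ m ∎)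
    where open ≡-Reasoning

integer-mono : ∀ {m n} → m ℤ.≤ n → integer m ≤ᴳ integer n
integer-mono {m} h with k , refl ← diff h = mono+ k m

integer-cancel : ∀ {m n} → integer m ≤ᴳ integer n → m ℤ.≤ n
integer-cancel {m} {n} h with m ℤ.≤? n
... | yes p = p
... | no ¬p = ⊥-elim (integer-< n (≤ᴳ-trans {integer (ℤ.suc n)} {integer m}
        (integer-mono (ℤ.i<j⇒suc[i]≤j (ℤ.≰⇒> ¬p))) h))

Fits : Game → ℤ → Set
Fits G n = (∀ i → ¬ integer n ≤ᴳ left G i) × (∀ j → ¬ right G j ≤ᴳ integer n)

simplicity⁺ : ∀ G n → Fits G (+ n) → IsInteger G
simplicity⁺ G zero (p , q) = + 0 ,
  ≤-intro {integer (+ 0)} {G} (λ ()) q , ≤-intro {G} {integer (+ 0)} p (λ ())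
simplicity⁺ G (suc n) (p , q) with G ≤ᴳ? integer (+ n)
... | yes h = simplicity⁺ G n (≤-left h , λ j h′ → q j
        (≤ᴳ-trans {right G j} {integer (+ n)} h′ (integer-step (+ n))))
... | no ¬h = + suc n ,
  ≤-intro {integer (+ suc n)} {G} (λ _ → ¬h) q , ≤-intro {G} {integer (+ suc n)} p (λ ())
simplicity⁻ : ∀ G n → Fits G -[1+ n ] → IsInteger G
simplicity⁻ G zero (p , q) with integer (+ 0) ≤ᴳ? G
... | yes h = simplicity⁺ G 0 ((λ i h′ → p i
        (≤ᴳ-trans {integer -[1+ 0 ]} {integer (+ 0)} (integer-step -[1+ 0 ]) h′)) , ≤-right h)
... | no ¬h = -[1+ 0 ] ,
  ≤-intro {integer -[1+ 0 ]} {G} (λ ()) q , ≤-intro {G} {integer -[1+ 0 ]} p (λ _ → ¬h)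
simplicity⁻ G (suc n) (p , q) with integer -[1+ n ] ≤ᴳ? G
... | yes h = simplicity⁻ G n ((λ i h′ → p i
        (≤ᴳ-trans {integer -[1+ suc n ]} {integer -[1+ n ]} (integer-step -[1+ suc n ]) h′)) , ≤-right h)
... | no ¬h = -[1+ suc n ] ,
  ≤-intro {integer -[1+ suc n ]} {G} (λ ()) q , ≤-intro {G} {integer -[1+ suc n ]} p (λ _ → ¬h)

simplicity : ∀ G n → Fits G n → IsInteger G
simplicity G (+ n)    = simplicity⁺ G n
simplicity G -[1+ n ] = simplicity⁻ G n

fits : ∀ G n → G ≈ᴳ integer n → Fits G n
fits G n (p , q) = ≤-left q , ≤-right p

right-integer : ∀ n j → right (integer n) j ≡ integer (ℤ.suc n)
right-integer (+ zero)     ()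
right-integer (+ suc n)    ()
right-integer -[1+ zero ]  zero = refl
right-integer -[1+ suc n ] zero = refl

left-integer : ∀ n i → left (integer n) i ≡ integer (ℤ.pred n)
left-integer (+ suc n)    zero = refl
left-integer -[1+ zero ]  ()
left-integer -[1+ suc n ] ()

noninteger-≤ : ∀ G n → ¬ IsInteger G → (∀ i → ¬ integer n ≤ᴳ left G i) → G ≤ᴳ integer n
noninteger-≤ G n ¬G p = ≤-intro {G} {integer n} p λ j h → lemma (subst (λ x → x ≤ᴳ G) (right-integer n j) h)
  where
  lemma : ¬ integer (ℤ.suc n) ≤ᴳ G
  lemma h = ¬G (simplicity G (ℤ.suc n)
    ((λ i q → p i (≤ᴳ-trans {integer n} {integer (ℤ.suc n)} (integer-step n) q)) , ≤-right h))

noninteger-≥ : ∀ G n → ¬ IsInteger G → (∀ j → ¬ right G j ≤ᴳ integer n) → integer n ≤ᴳ G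
noninteger-≥ G n ¬G q = ≤-intro {integer n} {G} (λ i h → lemma (subst (λ x → G ≤ᴳ x) (left-integer n i) h)) q
  where
  lemma : ¬ G ≤ᴳ integer (ℤ.pred n)
  lemma h = ¬G (simplicity G (ℤ.pred n)
    (≤-left h , λ j r → q j (≤ᴳ-trans {right G j} {integer (ℤ.pred n)} r (integer-mono (ℤ.i≤j⇒pred[i]≤j ℤ.≤-refl)))))

------------------------------------------------------------------------
-- Arithmetic of dyadic rationals

<⇒≤ : ∀ {x y} → x < y → x ≤ y
<⇒≤ (*<* h) = *≤* (ℚ.<⇒≤ h)

≰⇒> : ∀ {x y} → ¬ x ≤ y → y < x
≰⇒> h = *<* (ℚ.≰⇒> (h ∘ *≤*))

<⇒≱ : ∀ {x y} → x < y → ¬ y ≤ x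
<⇒≱ (*<* h) (*≤* h′) = ℚ.<-irrefl refl (ℚ.<-≤-trans h h′)

-- A decision procedure for linear identities over ℚ.
module Linear where
  data Expr (n : ℕ) : Set where
    var  : Fin n → Expr n
    _:+_ : Expr n → Expr n → Expr n
    :-_  : Expr n → Expr n
    :0   : Expr n

  infixl 6 _:+_
  infix 8 :-_

  Env : ℕ → Set
  Env n = Vec ℚ n

  ⟦_⟧ : ∀ {n} → Expr n → Env n → ℚ
  ⟦ var i ⟧ ρ  = Vec.lookup ρ i
  ⟦ a :+ b ⟧ ρ = ⟦ a ⟧ ρ ℚ.+ ⟦ b ⟧ ρ
  ⟦ :- a ⟧ ρ   = ℚ.- ⟦ a ⟧ ρ
  ⟦ :0 ⟧ ρ     = 0ℚ

  normal : ∀ {n} → Expr n → Vec ℤ n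
  normal (var i)  = Vec.replicate _ 0ℤ Vec.[ i ]≔ 1ℤ
  normal (a :+ b) = Vec.zipWith ℤ._+_ (normal a) (normal b)
  normal (:- a)   = Vec.map ℤ.-_ (normal a)
  normal :0       = Vec.replicate _ 0ℤ

  combine : ∀ {n} → Vec ℤ n → Env n → ℚ
  combine Vec.[]       Vec.[]       = 0ℚ
  combine (c Vec.∷ cs) (x Vec.∷ ρ) = c / 1 ℚ.* x ℚ.+ combine cs ρ

  ⟦_⇓⟧ : ∀ {n} → Expr n → Env n → ℚ
  ⟦ e ⇓⟧ = combine (normal e)

  open ≡-Reasoning

  combine-0 : ∀ {n} (ρ : Env n) → combine (Vec.replicate _ 0ℤ) ρ ≡ 0ℚ
  combine-0 Vec.[] = refl
  combine-0 (x Vec.∷ ρ) = cong₂ ℚ._+_ (ℚ.*-zeroˡ x) (combine-0 ρ)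

  combine-1 : ∀ {n} (i : Fin n) (ρ : Env n) → combine (Vec.replicate _ 0ℤ Vec.[ i ]≔ 1ℤ) ρ ≡ Vec.lookup ρ i
  combine-1 zero (x Vec.∷ ρ) = trans (cong₂ ℚ._+_ (ℚ.*-identityˡ x) (combine-0 ρ)) (ℚ.+-identityʳ x)
  combine-1 (suc i) (x Vec.∷ ρ) = trans (cong₂ ℚ._+_ (ℚ.*-zeroˡ x) (combine-1 i ρ)) (ℚ.+-identityˡ _)

  /1-+ : ∀ a b → (a ℤ.+ b) / 1 ≡ a / 1 ℚ.+ b / 1
  /1-+ a b = sym (trans (/-+-/ a b 1 1) (cong (_/ 1) (cong₂ ℤ._+_ (ℤ.*-identityʳ a) (ℤ.*-identityʳ b))))

  swap4 : ∀ a b c d → (a ℚ.+ b) ℚ.+ (c ℚ.+ d) ≡ (a ℚ.+ c) ℚ.+ (b ℚ.+ d)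
  swap4 = Semigroup.interchange
    where module Semigroup = Algebra.Properties.CommutativeSemigroup
            (Algebra.CommutativeMonoid.commutativeSemigroup ℚ.+-0-commutativeMonoid)

  combine-+ : ∀ {n} (as bs : Vec ℤ n) ρ → combine (Vec.zipWith ℤ._+_ as bs) ρ ≡ combine as ρ ℚ.+ combine bs ρ
  combine-+ Vec.[] Vec.[] Vec.[] = refl
  combine-+ (a Vec.∷ as) (b Vec.∷ bs) (x Vec.∷ ρ) = begin
    (a ℤ.+ b) / 1 ℚ.* x ℚ.+ combine (Vec.zipWith ℤ._+_ as bs) ρ
      ≡⟨ cong₂ ℚ._+_ (trans (cong (ℚ._* x) (/1-+ a b)) (ℚ.*-distribʳ-+ x (a / 1) (b / 1))) (combine-+ as bs ρ) ⟩
    (a / 1 ℚ.* x ℚ.+ b / 1 ℚ.* x) ℚ.+ (combine as ρ ℚ.+ combine bs ρ)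
      ≡⟨ swap4 (a / 1 ℚ.* x) (b / 1 ℚ.* x) (combine as ρ) (combine bs ρ) ⟩
    _ ∎

  combine-neg : ∀ {n} (as : Vec ℤ n) ρ → combine (Vec.map ℤ.-_ as) ρ ≡ ℚ.- combine as ρ
  combine-neg Vec.[] Vec.[] = refl
  combine-neg (a Vec.∷ as) (x Vec.∷ ρ) = trans
    (cong₂ ℚ._+_ (trans (cong (ℚ._* x) (sym (neg-/ a 1))) (sym (ℚ.neg-distribˡ-* (a / 1) x))) (combine-neg as ρ))
    (sym (ℚ.neg-distrib-+ (a / 1 ℚ.* x) (combine as ρ)))

  correct : ∀ {n} (e : Expr n) ρ → ⟦ e ⇓⟧ ρ ≡ ⟦ e ⟧ ρ
  correct (var i) ρ = combine-1 i ρ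
  correct (a :+ b) ρ = trans (combine-+ (normal a) (normal b) ρ) (cong₂ ℚ._+_ (correct a ρ) (correct b ρ))
  correct (:- a) ρ = trans (combine-neg (normal a) ρ) (cong ℚ.-_ (correct a ρ))
  correct :0 ρ = combine-0 ρ

  open Reflection (setoid ℚ) var ⟦_⟧ ⟦_⇓⟧ correct public
    using (solve) renaming (_⊜_ to _:=_)

open Linear using (solve; _:=_; _:+_; :-_; :0) public

≤-reflexive : ∀ {x y} → x ≡ y → x ≤ y
≤-reflexive refl = ≤-refl

private
  to0 : ∀ {p q} → p ℚ.≤ q → 0ℚ ℚ.≤ q ℚ.+ ℚ.- p
  to0 {p} {q} h = subst (ℚ._≤ q ℚ.+ ℚ.- p) (ℚ.+-inverseʳ p) (ℚ.+-monoˡ-≤ (ℚ.- p) h)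

  from0 : ∀ {p q} → 0ℚ ℚ.≤ q ℚ.+ ℚ.- p → p ℚ.≤ q
  from0 {p} {q} h = subst₂ ℚ._≤_ (ℚ.+-identityˡ p)
    (solve 2 (λ p q → (q :+ :- p) :+ p := q) refl p q) (ℚ.+-monoˡ-≤ p h)

lin₁ : ∀ {a b c d} → a ≤ b → value (d - c) ≡ value (b - a) → c ≤ d
lin₁ (*≤* h) e = *≤* (from0 (subst (0ℚ ℚ.≤_) (sym e) (to0 h)))

lin₂ : ∀ {a b a′ b′ c d} → a ≤ b → a′ ≤ b′ → value (d - c) ≡ value ((b - a) + (b′ - a′)) → c ≤ d
lin₂ (*≤* h) (*≤* h′) e = *≤* (from0 (subst₂ ℚ._≤_ refl (sym e) (ℚ.+-mono-≤ (to0 h) (to0 h′))))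

grid : ℕ → ℤ → 𝔻
grid k i = mk𝔻 (i /2^ k) (i , k , refl)

grid-+ : ∀ k i j → grid k i + grid k j ≡ grid k (i ℤ.+ j)
grid-+ k i j = value-injective (trans
  (/-+-/ i j p p {{nz}} {{nz}} {{nz²}})
  (/-≡ (i ℤ.* + p ℤ.+ j ℤ.* + p) (i ℤ.+ j) (p ℕ.* p) p {{nz²}} {{nz}}
    (trans (lemma i j (+ p)) (cong (λ x → (i ℤ.+ j) ℤ.* x) (sym (ℤ.pos-* p p))))))
  where
  p = 2 ℕ.^ k
  nz = ℕ.m^n≢0 2 k
  nz² = ℕ.m*n≢0 p p {{nz}} {{nz}}
  lemma : ∀ i j p → (i ℤ.* p ℤ.+ j ℤ.* p) ℤ.* p ≡ (i ℤ.+ j) ℤ.* (p ℤ.* p)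
  lemma = solve-∀

grid-neg : ∀ k i → - grid k i ≡ grid k (ℤ.- i)
grid-neg k i = value-injective (neg-/ i (2 ℕ.^ k) {{ℕ.m^n≢0 2 k}})

grid-mono : ∀ k {i j} → i ℤ.≤ j → grid k i ≤ grid k j
grid-mono k {i} {j} h = *≤* (/-≤ i j p p {{ℕ.m^n≢0 2 k}} {{ℕ.m^n≢0 2 k}} (ℤ.*-monoʳ-≤-nonNeg (+ p) h))
  where p = 2 ℕ.^ k

grid-cancel : ∀ k {i j} → grid k i ≤ grid k j → i ℤ.≤ j
grid-cancel k {i} {j} (*≤* h) = ℤ.*-cancelʳ-≤-pos i j (+ p) {{ℤ.positive (ℤ.+<+ (ℕ.m^n>0 2 k))}}
    (/-≤⁻ i j p p {{ℕ.m^n≢0 2 k}} {{ℕ.m^n≢0 2 k}} h)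
  where p = 2 ℕ.^ k

grid-refine : ∀ k d i → grid k i ≡ grid (k ℕ.+ d) (i ℤ.* + (2 ℕ.^ d))
grid-refine k d i = value-injective (/-≡ i (i ℤ.* + (2 ℕ.^ d)) (2 ℕ.^ k) (2 ℕ.^ (k ℕ.+ d))
    {{ℕ.m^n≢0 2 k}} {{ℕ.m^n≢0 2 (k ℕ.+ d)}}
    (trans (cong (λ x → i ℤ.* x) (trans (cong +_ (trans (ℕ.^-distribˡ-+-* 2 k d) (ℕ.*-comm (2 ℕ.^ k) (2 ℕ.^ d)))) (ℤ.pos-* (2 ℕ.^ d) (2 ℕ.^ k))))
           (sym (ℤ.*-assoc i (+ (2 ℕ.^ d)) (+ (2 ℕ.^ k))))))

fromℤ-cancel : ∀ {i j} → fromℤ i ≤ fromℤ j → i ℤ.≤ j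
fromℤ-cancel = grid-cancel 0

bound : ∀ x → ∃ λ (n : ℕ) → x ≤ fromℤ (+ n)
bound x = ℤ.∣ ℚ.↥ (value x) ∣ , *≤* (subst₂ ℚ._≤_ (ℚ.↥p/↧p≡p (value x)) refl
   (/-≤ (ℚ.↥ value x) (+ ℤ.∣ ℚ.↥ value x ∣) (ℚ.↧ₙ value x) 1
     (ℤ.≤-trans (ℤ.≤-reflexive (ℤ.*-identityʳ (ℚ.↥ value x)))
     (ℤ.≤-trans (i≤∣i∣ (ℚ.↥ value x))
     (ℤ.≤-trans (ℤ.+≤+ (ℕ.m≤m*n ℤ.∣ ℚ.↥ value x ∣ (ℚ.↧ₙ value x))) (ℤ.≤-reflexive (ℤ.pos-* ℤ.∣ ℚ.↥ value x ∣ (ℚ.↧ₙ value x))))))))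
  where
  i≤∣i∣ : ∀ i → i ℤ.≤ + ℤ.∣ i ∣
  i≤∣i∣ (+ n) = ℤ.≤-refl
  i≤∣i∣ -[1+ n ] = ℤ.-≤+

------------------------------------------------------------------------
-- Existence of the cooling functions

module Construction where

  Cell : ℕ → ℤ → 𝔻 → Set
  Cell k i t = grid k i ≤ t × t ≤ grid k (ℤ.suc i)

  -- On the cell [i/2ᵏ , (i+1)/2ᵏ], f has slope 0 or −1 and f(t) or f(t) + t is in ℤ/2ᵏ.
  data Piece (f : 𝔻 → 𝔻) (k : ℕ) (i : ℤ) : Set where
    flat : ∀ w → (∀ {t} → Cell k i t → f t ≡ grid k w) → Piece f k i
    fall : ∀ w → (∀ {t} → Cell k i t → f t ≡ grid k w - t) → Piece f k i

  -- Both t ↦ λₜ(G) and t ↦ −ρₜ(G) are of this kind.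
  record Wall (f : 𝔻 → 𝔻) : Set where
    field
      anti   : ∀ {t s} → t ≤ s → f s ≤ f t
      slow   : ∀ {t s} → t ≤ s → f t + t ≤ f s + s
      level  : ℕ
      pieces : ∀ {k} → level ℕ.≤ k → ∀ i → Piece f k i
  open Wall

  cell-left : ∀ k i → Cell k i (grid k i)
  cell-left k i = ≤-refl , grid-mono k (ℤ.i≤suc[i] i)

  cell-right : ∀ k i → Cell k i (grid k (ℤ.suc i))
  cell-right k i = grid-mono k (ℤ.i≤suc[i] i) , ≤-refl

  ≤-resp : ∀ {x x′ y y′} → x ≡ x′ → y ≡ y′ → x′ ≤ y′ → x ≤ y
  ≤-resp refl refl h = h

  grid-refine′ : ∀ {k k′} i → k ℕ.≤ k′ → ∃ λ i′ → grid k i ≡ grid k′ i′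
  grid-refine′ {k} {k′} i h = i ℤ.* + (2 ℕ.^ (k′ ℕ.∸ k)) ,
    trans (grid-refine k (k′ ℕ.∸ k) i) (cong (λ l → grid l (i ℤ.* + (2 ℕ.^ (k′ ℕ.∸ k)))) (ℕ.m+[n∸m]≡n h))

  constant-wall : ∀ n → Wall (λ _ → fromℤ n)
  constant-wall n = record
    { anti = λ _ → ≤-refl
    ; slow = λ {t} {s} h → lin₁ h (solve 3 (λ n t s → (n :+ s) :+ :- (n :+ t) := s :+ :- t) refl
                                    (value (fromℤ n)) (value t) (value s))
    ; level = 0
    ; pieces = λ {k} _ i → let (w , e) = grid-refine′ {0} {k} n ℕ.z≤n in flat w λ _ → e
    }

  step-wall : ∀ {f} → Wall f → Wall (λ t → - f t - t)
  step-wall {f} W = record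
    { anti = λ {t} {s} h → lin₁ (slow W h)
        (solve 4 (λ ft fs t s → ((:- ft) :+ (:- t)) :+ :- ((:- fs) :+ :- s) := (fs :+ s) :+ :- (ft :+ t)) refl
          (value (f t)) (value (f s)) (value t) (value s))
    ; slow = λ {t} {s} h → lin₁ (anti W h)
        (solve 4 (λ ft fs t s → (((:- fs) :+ (:- s)) :+ s) :+ :- (((:- ft) :+ :- t) :+ t) := ft :+ :- fs) refl
          (value (f t)) (value (f s)) (value t) (value s))
    ; level = level W
    ; pieces = λ {k} h i → piece k i (pieces W h i)
    }
    where
    piece : ∀ k i → Piece f k i → Piece (λ t → - f t - t) k i
    piece k i (flat w p) = fall (ℤ.- w) λ {t} c → cong (λ x → x - t) (trans (cong -_ (p c)) (grid-neg k w))
    piece k i (fall w p) = flat (ℤ.- w) λ {t} c → trans (cong (λ x → - x - t) (p c))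
      (trans (value-injective (solve 2 (λ w t → (:- (w :+ :- t)) :+ :- t := :- w) refl (value (grid k w)) (value t)))
             (grid-neg k w))

  ⊔-wall : ∀ {f g} → Wall f → Wall g → Wall (λ t → f t ⊔ g t)
  ⊔-wall {f} {g} W V = record
    { anti = λ {t} {s} h → Max.⊔-mono-≤ (anti W h) (anti V h)
    ; slow = λ {t} {s} h → [ (λ e → ≤-resp (cong (λ x → x + t) e) refl (≤-trans (slow W h) (mono+ʳ s (Max.x≤x⊔y (f s) (g s)))))
                          , (λ e → ≤-resp (cong (λ x → x + t) e) refl (≤-trans (slow V h) (mono+ʳ s (Max.x≤y⊔x (f s) (g s))))) ]′
                          (Max.⊔-sel (f t) (g t))
    ; level = level W ℕ.⊔ level V
    ; pieces = λ {k} h i → piece k i (pieces W (ℕ.≤-trans (ℕ.m≤m⊔n _ _) h) i) (pieces V (ℕ.≤-trans (ℕ.m≤n⊔m _ _) h) i)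
    }
    where
    mono+ʳ : ∀ s {x y} → x ≤ y → x + s ≤ y + s
    mono+ʳ s {x} {y} h = lin₁ h (solve 3 (λ x y s → (y :+ s) :+ :- (x :+ s) := y :+ :- x) refl (value x) (value y) (value s))

    Result : ℕ → ℤ → Set
    Result k i = (∀ {t} → Cell k i t → f t ≤ g t) ⊎ (∀ {t} → Cell k i t → g t ≤ f t)

    total- : ∀ k w w′ t → w ℤ.≤ w′ → grid k w - t ≤ grid k w′ - t
    total- k w w′ t h = mono+ʳ (- t) (grid-mono k h)

    above : ∀ k i w w′ t → w′ ℤ.≤ i ℤ.+ w → grid k i ≤ t → grid k w′ - t ≤ grid k w
    above k i w w′ t h c = lin₂ c (≤-resp refl (grid-+ k i w) (grid-mono k h))
      (solve 4 (λ w w′ t i → w :+ :- (w′ :+ :- t) := (t :+ :- i) :+ ((i :+ w) :+ :- w′)) refl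
        (value (grid k w)) (value (grid k w′)) (value t) (value (grid k i)))

    below : ∀ k i w w′ t → ℤ.suc i ℤ.+ w ℤ.≤ w′ → t ≤ grid k (ℤ.suc i) → grid k w ≤ grid k w′ - t
    below k i w w′ t h c = lin₂ c (≤-resp (grid-+ k (ℤ.suc i) w) refl (grid-mono k h))
      (solve 4 (λ w w′ t i → (w′ :+ :- t) :+ :- w := (i :+ :- t) :+ (w′ :+ :- (i :+ w))) refl
        (value (grid k w)) (value (grid k w′)) (value t) (value (grid k (ℤ.suc i))))

    suc≤ : ∀ i w w′ → ¬ w′ ℤ.≤ i ℤ.+ w → ℤ.suc i ℤ.+ w ℤ.≤ w′
    suc≤ i w w′ h = ℤ.≤-trans (ℤ.≤-reflexive (ℤ.+-assoc 1ℤ i w)) (ℤ.i<j⇒suc[i]≤j (ℤ.≰⇒> h))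

    compare : ∀ k i → Piece f k i → Piece g k i → Result k i
    compare k i (flat w p) (flat w′ q) = Sum.map
      (λ h c → ≤-resp (p c) (q c) (grid-mono k h)) (λ h c → ≤-resp (q c) (p c) (grid-mono k h)) (ℤ.≤-total w w′)
    compare k i (fall w p) (fall w′ q) = Sum.map
      (λ h {t} c → ≤-resp (p c) (q c) (total- k w w′ t h)) (λ h {t} c → ≤-resp (q c) (p c) (total- k w′ w t h)) (ℤ.≤-total w w′)
    compare k i (flat w p) (fall w′ q) with w′ ℤ.≤? i ℤ.+ w
    ... | yes h = inj₂ λ {t} c → ≤-resp (q c) (p c) (above k i w w′ t h (proj₁ c))
    ... | no ¬h = inj₁ λ {t} c → ≤-resp (p c) (q c) (below k i w w′ t (suc≤ i w w′ ¬h) (proj₂ c))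
    compare k i (fall w p) (flat w′ q) with w ℤ.≤? i ℤ.+ w′
    ... | yes h = inj₁ λ {t} c → ≤-resp (p c) (q c) (above k i w′ w t h (proj₁ c))
    ... | no ¬h = inj₂ λ {t} c → ≤-resp (q c) (p c) (below k i w′ w t (suc≤ i w′ w ¬h) (proj₂ c))

    copy : ∀ {h h′ : 𝔻 → 𝔻} k i → (∀ {t} → Cell k i t → h′ t ≡ h t) → Piece h k i → Piece h′ k i
    copy k i e (flat w p) = flat w λ c → trans (e c) (p c)
    copy k i e (fall w p) = fall w λ c → trans (e c) (p c)

    piece : ∀ k i → Piece f k i → Piece g k i → Piece (λ t → f t ⊔ g t) k i
    piece k i P Q with compare k i P Q
    ... | inj₁ h = copy k i (λ c → Max.x≤y⇒x⊔y≈y (h c)) Q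
    ... | inj₂ h = copy k i (λ c → Max.x≤y⇒y⊔x≈y (h c)) P

  maximum-wall : ∀ {n} (f : Fin (suc n) → 𝔻 → 𝔻) → (∀ i → Wall (f i)) → Wall (λ t → maximum (λ i → f i t))
  maximum-wall {zero} f W = W zero
  maximum-wall {suc n} f W = ⊔-wall (W zero) (maximum-wall (f ∘ suc) (W ∘ suc))

  cut-wall : ∀ {f} k₀ j → Wall f → Wall (λ t → f (t ⊓ grid k₀ j))
  cut-wall {f} k₀ j W = record
    { anti = λ {t} {s} h → anti W (Min.⊓-monoˡ-≤ τ h)
    ; slow = λ {t} {s} h → lin₂ (slow W (Min.⊓-monoˡ-≤ τ h)) (gap h)
       (solve 6 (λ ft fs t s t′ s′ → (fs :+ s) :+ :- (ft :+ t) := ((fs :+ s′) :+ :- (ft :+ t′)) :+ ((s :+ :- s′) :+ :- (t :+ :- t′)))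
         refl (value (f (t ⊓ τ))) (value (f (s ⊓ τ))) (value t) (value s) (value (t ⊓ τ)) (value (s ⊓ τ)))
    ; level = k₀ ℕ.⊔ level W
    ; pieces = λ {k} h i → piece k i (ℕ.≤-trans (ℕ.m≤m⊔n _ _) h) (ℕ.≤-trans (ℕ.m≤n⊔m _ _) h)
    }
    where
    τ = grid k₀ j

    gap : ∀ {t s} → t ≤ s → t - (t ⊓ τ) ≤ s - (s ⊓ τ)
    gap {t} {s} h = [ both-below , [ split , both-above ]′ (≤-total t τ) ]′ (≤-total s τ)
      where
      at-t : ∀ {x} → t ⊓ τ ≡ x → t - (t ⊓ τ) ≡ t - x
      at-t = cong (λ x → t - x)
      at-s : ∀ {x} → s ⊓ τ ≡ x → s - (s ⊓ τ) ≡ s - x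
      at-s = cong (λ x → s - x)
      both-below : s ≤ τ → t - (t ⊓ τ) ≤ s - (s ⊓ τ)
      both-below s≤τ = ≤-reflexive (trans (at-t (Min.x≤y⇒x⊓y≈x (≤-trans h s≤τ)))
        (trans (value-injective (solve 2 (λ t s → t :+ :- t := s :+ :- s) refl (value t) (value s)))
               (sym (at-s (Min.x≤y⇒x⊓y≈x s≤τ)))))
      split : t ≤ τ → τ ≤ s → t - (t ⊓ τ) ≤ s - (s ⊓ τ)
      split t≤τ τ≤s = ≤-resp (at-t (Min.x≤y⇒x⊓y≈x t≤τ)) (at-s (Min.x≤y⇒y⊓x≈x τ≤s)) (lin₁ τ≤s
        (solve 3 (λ t s τ → (s :+ :- τ) :+ :- (t :+ :- t) := s :+ :- τ) refl (value t) (value s) (value τ)))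
      both-above : τ ≤ t → τ ≤ s → t - (t ⊓ τ) ≤ s - (s ⊓ τ)
      both-above τ≤t τ≤s = ≤-resp (at-t (Min.x≤y⇒y⊓x≈x τ≤t)) (at-s (Min.x≤y⇒y⊓x≈x τ≤s)) (lin₁ h
        (solve 3 (λ t s τ → (s :+ :- τ) :+ :- (t :+ :- τ) := s :+ :- t) refl (value t) (value s) (value τ)))

    piece : ∀ k i → k₀ ℕ.≤ k → level W ℕ.≤ k → Piece (λ t → f (t ⊓ τ)) k i
    piece k i k₀≤k l≤k with grid-refine′ j k₀≤k
    ... | j′ , e with ℤ.suc i ℤ.≤? j′
    ...   | yes h = before (pieces W l≤k i)
      where
      t≤τ : ∀ {t} → Cell k i t → t ≤ τ
      t≤τ (_ , c) = ≤-trans c (≤-resp refl e (grid-mono k h))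
      before : Piece f k i → Piece (λ t → f (t ⊓ τ)) k i
      before (flat w p) = flat w λ c → trans (cong f (Min.x≤y⇒x⊓y≈x (t≤τ c))) (p c)
      before (fall w p) = fall w λ c → trans (cong f (Min.x≤y⇒x⊓y≈x (t≤τ c))) (p c)
    ...   | no ¬h = after (pieces W l≤k j′)
      where
      j′≤i : j′ ℤ.≤ i
      j′≤i = subst (λ x → j′ ℤ.≤ x) (ℤ.pred-suc i) (ℤ.i<j⇒i≤pred[j] (ℤ.≰⇒> ¬h))
      τ≤t : ∀ {t} → Cell k i t → τ ≤ t
      τ≤t (c , _) = ≤-trans (≤-resp e refl (grid-mono k j′≤i)) c
      fτ : ∀ {t} → Cell k i t → f (t ⊓ τ) ≡ f (grid k j′)
      fτ c = cong f (trans (Min.x≤y⇒y⊓x≈x (τ≤t c)) e)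
      after : Piece f k j′ → Piece (λ t → f (t ⊓ τ)) k i
      after (flat w p) = flat w λ c → trans (fτ c) (p (cell-left k j′))
      after (fall w p) = flat (w ℤ.+ ℤ.- j′) λ c → trans (fτ c) (trans (p (cell-left k j′))
        (trans (cong (λ x → grid k w + x) (grid-neg k j′)) (grid-+ k w (ℤ.- j′))))

  cross : (P : ℕ → Set) → (∀ n → Dec (P n)) → ¬ P 0 → ∀ N → P N → ∃ λ n → ¬ P n × P (suc n)
  cross P P? ¬P0 zero    p = contradiction p ¬P0
  cross P P? ¬P0 (suc N) p with P? N
  ... | yes q = cross P P? ¬P0 N q
  ... | no ¬q = N , ¬q , p

  -1𝔻 : 𝔻
  -1𝔻 = fromℤ -1ℤ

  record Crossing (f g : 𝔻 → 𝔻) : Set where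
    field
      k₀       : ℕ
      j₀       : ℤ
    τ : 𝔻
    τ = grid k₀ j₀
    field
      meet     : f τ ≡ - g τ
      earliest : ∀ s → f s ≤ - g s → τ ≤ s

  module InCell {f g} (W : Wall f) (V : Wall g) {K} (W≤K : level W ℕ.≤ K) (V≤K : level V ℕ.≤ K) (i : ℤ)
    (l≰ : ¬ f (grid K i) ≤ - g (grid K i)) (r≤ : f (grid K (ℤ.suc i)) ≤ - g (grid K (ℤ.suc i))) where

    l = grid K i
    r = grid K (ℤ.suc i)

    finish : ∀ k₀ j₀ → let τ = grid k₀ j₀ in
      (∀ {t} → Cell K i t → f t ≤ - g t → τ ≤ t) →
      (∀ {t} → Cell K i t → τ ≤ t → f t ≤ - g t) →
      (Cell K i τ → f τ ≡ - g τ) → Crossing f g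
    finish k₀ j₀ to from at = record { k₀ = k₀ ; j₀ = j₀ ; meet = at (l≤τ , τ≤r) ; earliest = earliest }
      where
      τ = grid k₀ j₀
      l≤τ : l ≤ τ
      l≤τ = [ (λ h → h) , (λ h → contradiction (from (cell-left K i) h) l≰) ]′ (≤-total l τ)
      τ≤r : τ ≤ r
      τ≤r = to (cell-right K i) r≤
      earliest : ∀ s → f s ≤ - g s → τ ≤ s
      earliest s h with ≤-total τ s
      ... | inj₁ τ≤s = τ≤s
      ... | inj₂ s≤τ with ≤-total l s
      ...   | inj₁ l≤s = to (l≤s , ≤-trans s≤τ τ≤r) h
      ...   | inj₂ s≤l = contradiction (≤-trans (anti W s≤l) (≤-trans h (lin₁ (anti V s≤l)
                (solve 2 (λ x y → (:- x) :+ :- (:- y) := y :+ :- x) refl (value (g l)) (value (g s)))))) l≰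

    module _ (w w′ : ℤ) where
      u = w ℤ.+ w′
      w+w′ : grid K w + grid K w′ ≡ grid K u
      w+w′ = grid-+ K w w′
      x = value (grid K w)
      y = value (grid K w′)

      fall-flat : (∀ {t} → Cell K i t → f t ≡ grid K w - t) → (∀ {t} → Cell K i t → g t ≡ grid K w′) → Crossing f g
      fall-flat F G = finish K u
        (λ {t} c h → ≤-resp (sym w+w′) refl (lin₁ (≤-resp (sym (F c)) (cong -_ (sym (G c))) h)
          (solve 3 (λ x y t → t :+ :- (x :+ y) := (:- y) :+ :- (x :+ :- t)) refl x y (value t))))
        (λ {t} c h → ≤-resp (F c) (cong -_ (G c)) (lin₁ (≤-resp w+w′ refl h)
          (solve 3 (λ x y t → (:- y) :+ :- (x :+ :- t) := t :+ :- (x :+ y)) refl x y (value t))))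
        (λ c → trans (F c) (trans (cong (λ z → grid K w - z) (sym w+w′))
          (trans (value-injective (solve 2 (λ x y → x :+ :- (x :+ y) := :- y) refl x y)) (cong -_ (sym (G c))))))

      flat-fall : (∀ {t} → Cell K i t → f t ≡ grid K w) → (∀ {t} → Cell K i t → g t ≡ grid K w′ - t) → Crossing f g
      flat-fall F G = finish K u
        (λ {t} c h → ≤-resp (sym w+w′) refl (lin₁ (≤-resp (sym (F c)) (cong -_ (sym (G c))) h)
          (solve 3 (λ x y t → t :+ :- (x :+ y) := (:- (y :+ :- t)) :+ :- x) refl x y (value t))))
        (λ {t} c h → ≤-resp (F c) (cong -_ (G c)) (lin₁ (≤-resp w+w′ refl h)
          (solve 3 (λ x y t → (:- (y :+ :- t)) :+ :- x := t :+ :- (x :+ y)) refl x y (value t))))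
        (λ c → trans (F c) (trans (value-injective (solve 2 (λ x y → x := :- (y :+ :- (x :+ y))) refl x y))
          (trans (cong (λ z → - (grid K w′ - z)) w+w′) (cong -_ (sym (G c))))))

      τ₂ = grid (K ℕ.+ 1) u
      double : ∀ u → u ℤ.* + 2 ≡ u ℤ.+ u
      double = solve-∀
      τ₂+τ₂ : τ₂ + τ₂ ≡ grid K w + grid K w′
      τ₂+τ₂ = trans (grid-+ (K ℕ.+ 1) u u) (trans (cong (grid (K ℕ.+ 1)) (sym (double u)))
        (trans (sym (grid-refine K 1 u)) (sym w+w′)))

      fall-fall : (∀ {t} → Cell K i t → f t ≡ grid K w - t) → (∀ {t} → Cell K i t → g t ≡ grid K w′ - t) → Crossing f g
      fall-fall F G = finish (K ℕ.+ 1) u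
        (λ {t} c h → halve (≤-resp τ₂+τ₂ refl (lin₁ {d = t + t} (≤-resp (sym (F c)) (cong -_ (sym (G c))) h)
          (solve 3 (λ x y t → (t :+ t) :+ :- (x :+ y) := (:- (y :+ :- t)) :+ :- (x :+ :- t)) refl x y (value t)))))
        (λ {t} c h → ≤-resp (F c) (cong -_ (G c)) (lin₁ {b = t + t} (≤-resp (sym τ₂+τ₂) refl (lin₂ h h
               (solve 2 (λ τ t → (t :+ t) :+ :- (τ :+ τ) := (t :+ :- τ) :+ (t :+ :- τ)) refl (value τ₂) (value t))))
          (solve 3 (λ x y t → (:- (y :+ :- t)) :+ :- (x :+ :- t) := (t :+ t) :+ :- (x :+ y)) refl x y (value t))))
        (λ c → trans (F c) (trans (value-injective (trans
          (solve 3 (λ x y t → x :+ :- t := ((x :+ y) :+ :- (t :+ t)) :+ :- (y :+ :- t)) refl x y (value τ₂))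
          (trans (cong (λ z → value ((z - (τ₂ + τ₂)) - (grid K w′ - τ₂))) (sym τ₂+τ₂))
            (solve 2 (λ y t → ((t :+ t) :+ :- (t :+ t)) :+ :- (y :+ :- t) := :- (y :+ :- t)) refl y (value τ₂)))))
          (cong -_ (sym (G c)))))
        where
        halve : ∀ {t} → τ₂ + τ₂ ≤ t + t → τ₂ ≤ t
        halve {t} h with ≤-total τ₂ t
        ... | inj₁ e = e
        ... | inj₂ e = lin₂ h e (solve 2 (λ τ t → t :+ :- τ := ((t :+ t) :+ :- (τ :+ τ)) :+ (τ :+ :- t)) refl (value τ₂) (value t))

    crossing′ : Crossing f g
    crossing′ with pieces W W≤K i | pieces V V≤K i
    ... | fall w F | flat w′ G = fall-flat w w′ F G
    ... | flat w F | fall w′ G = flat-fall w w′ F G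
    ... | fall w F | fall w′ G = fall-fall w w′ F G
    ... | flat w F | flat w′ G = contradiction
      (≤-resp (trans (F (cell-left K i)) (sym (F (cell-right K i))))
              (cong -_ (trans (G (cell-left K i)) (sym (G (cell-right K i))))) r≤) l≰

  crossing-proof : ∀ {f g} → Wall f → Wall g → ¬ f -1𝔻 ≤ - g -1𝔻 →
    (T : ℕ) → f (fromℤ (+ T)) ≤ - g (fromℤ (+ T)) → Crossing f g
  crossing-proof {f} {g} W V start T end =
    InCell.crossing′ W V (ℕ.m≤m⊔n _ _) (ℕ.m≤n⊔m _ _) (a n) (proj₁ (proj₂ found))
      (subst (λ x → f (grid K x) ≤ - g (grid K x)) (suc-a (+ p) (+ n)) (proj₂ (proj₂ found)))
    where
    K = level W ℕ.⊔ level V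
    p = 2 ℕ.^ K
    a : ℕ → ℤ
    a n = -1ℤ ℤ.* + p ℤ.+ + n
    P : ℕ → Set
    P n = f (grid K (a n)) ≤ - g (grid K (a n))
    a0 : grid K (a 0) ≡ -1𝔻
    a0 = trans (cong (grid K) (ℤ.+-identityʳ (-1ℤ ℤ.* + p))) (sym (grid-refine 0 K -1ℤ))
    N = p ℕ.+ T ℕ.* p
    arith : ∀ p T → -1ℤ ℤ.* p ℤ.+ (p ℤ.+ T ℤ.* p) ≡ T ℤ.* p
    arith = solve-∀
    aN : grid K (a N) ≡ fromℤ (+ T)
    aN = trans (cong (grid K) (trans (cong (λ x → -1ℤ ℤ.* + p ℤ.+ x) (trans (ℤ.pos-+ p (T ℕ.* p)) (cong (λ x → + p ℤ.+ x) (ℤ.pos-* T p))))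
        (arith (+ p) (+ T)))) (sym (grid-refine 0 K (+ T)))

    ¬P0 : ¬ P 0
    ¬P0 h = start (subst (λ t → f t ≤ - g t) a0 h)
    PN : P N
    PN = subst (λ t → f t ≤ - g t) (sym aN) end

    found = cross P (λ n → f (grid K (a n)) ≤? (- g (grid K (a n)))) ¬P0 N PN
    n = proj₁ found
    suc-a : ∀ p n → -1ℤ ℤ.* p ℤ.+ (1ℤ ℤ.+ n) ≡ 1ℤ ℤ.+ (-1ℤ ℤ.* p ℤ.+ n)
    suc-a = solve-∀

  abstract
    crossing : ∀ {f g} → Wall f → Wall g → ¬ f -1𝔻 ≤ - g -1𝔻 →
      (T : ℕ) → f (fromℤ (+ T)) ≤ - g (fromℤ (+ T)) → Crossing f g
    crossing = crossing-proof

  maximum-upper : ∀ {n} (v : Vector 𝔻 (suc n)) i → v i ≤ maximum v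
  maximum-upper {zero}  v zero = ≤-refl
  maximum-upper {suc n} v zero = Max.x≤x⊔y (v zero) (maximum (v ∘ suc))
  maximum-upper {suc n} v (suc i) = ≤-trans (maximum-upper (v ∘ suc) i) (Max.x≤y⊔x (v zero) (maximum (v ∘ suc)))

  maximum-lub : ∀ {n} (v : Vector 𝔻 (suc n)) {x} → (∀ i → v i ≤ x) → maximum v ≤ x
  maximum-lub {zero} v h = h zero
  maximum-lub {suc n} v h = Max.⊔-lub (h zero) (maximum-lub (v ∘ suc) (h ∘ suc))

  maximum-attained : ∀ {n} (v : Vector 𝔻 (suc n)) → ∃ λ i → maximum v ≡ v i
  maximum-attained {zero} v = zero , refl
  maximum-attained {suc n} v = [ (λ e → zero , e) , (λ e → let (i , e′) = maximum-attained (v ∘ suc) in suc i , trans e e′) ]′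
    (Max.⊔-sel (v zero) (maximum (v ∘ suc)))

  neg-antimono : ∀ {x y} → x ≤ y → - y ≤ - x
  neg-antimono {x} {y} h = lin₁ h (solve 2 (λ x y → :- x :+ :- (:- y) := y :+ :- x) refl (value x) (value y))

  neg-⊔ : ∀ x y → - (x ⊔ y) ≡ - x ⊓ - y
  neg-⊔ x y = [ (λ h → trans (cong -_ (Max.x≤y⇒x⊔y≈y h)) (sym (Min.x≤y⇒y⊓x≈x (neg-antimono h))))
              , (λ h → trans (cong -_ (Max.x≤y⇒y⊔x≈y h)) (sym (Min.x≤y⇒x⊓y≈x (neg-antimono h)))) ]′ (≤-total x y)

  minimum-flip : ∀ {n} (v w : Vector 𝔻 (suc n)) → (∀ j → v j ≡ - w j) → minimum v ≡ - maximum w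
  minimum-flip {zero} v w e = e zero
  minimum-flip {suc n} v w e = trans (cong₂ _⊓_ (e zero) (minimum-flip (v ∘ suc) (w ∘ suc) (e ∘ suc)))
    (sym (neg-⊔ (w zero) (maximum (w ∘ suc))))

  upper : ∀ {n} (v : Vector 𝔻 n) → ∃ λ T → ∀ i → v i ≤ fromℤ (+ T)
  upper {zero} v = 0 , λ ()
  upper {suc n} v =
    let (a , p) = bound (v zero)
        (b , q) = upper (v ∘ suc)
    in a ℕ.⊔ b , λ { zero    → ≤-trans p (grid-mono 0 (ℤ.+≤+ (ℕ.m≤m⊔n a b)))
                   ; (suc i) → ≤-trans (q i) (grid-mono 0 (ℤ.+≤+ (ℕ.m≤n⊔m a b))) }

  upperℤ : ∀ {n} (v : Vector ℤ n) → ∃ λ T → ∀ i → v i ℤ.≤ T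
  upperℤ {zero} v = 0ℤ , λ ()
  upperℤ {suc n} v = let (b , q) = upperℤ (v ∘ suc) in
    v zero ℤ.⊔ b , λ { zero → ℤ.i≤i⊔j (v zero) b ; (suc i) → ℤ.≤-trans (q i) (ℤ.i≤j⊔i (v zero) b) }

  largest : ∀ {n} (v : Vector ℤ (suc n)) → ∃ λ i → ∀ j → v j ℤ.≤ v i
  largest {zero} v = zero , λ { zero → ℤ.≤-refl }
  largest {suc n} v = let (i , p) = largest (v ∘ suc) in
    [ (λ h → suc i , λ { zero → h ; (suc j) → p j })
    , (λ h → zero , λ { zero → ℤ.≤-refl ; (suc j) → ℤ.≤-trans (p j) h }) ]′ (ℤ.≤-total (v zero) (v (suc i)))

  -- Is there an integer strictly between the xs and the ys?
  between : ∀ {m n} (x : Vector ℤ m) (y : Vector ℤ n) →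
    (∃ λ k → (∀ i → x i ℤ.< k) × (∀ j → k ℤ.< y j)) ⊎ (∃₂ λ i j → y j ℤ.≤ ℤ.suc (x i))
  between {zero} x y = let (T , p) = upperℤ (λ j → ℤ.- y j) in
    inj₁ (ℤ.pred (ℤ.- T) , (λ ()) , λ j → ℤ.≤-<-trans ℤ.≤-refl (ℤ.i≤pred[j]⇒i<j
      (ℤ.pred-mono (subst (λ x → ℤ.- T ℤ.≤ x) (ℤ.neg-involutive (y j)) (ℤ.neg-mono-≤ (p j))))))
  between {suc m} x y with largest x
  ... | i , p with all? (λ j → ℤ.suc (x i) ℤ.<? y j)
  ...   | yes q = inj₁ (ℤ.suc (x i) , (λ i′ → ℤ.suc[i]≤j⇒i<j (ℤ.suc-mono (p i′))) , q)
  ...   | no ¬q = inj₂ (i , find (λ j → y j ℤ.≤? ℤ.suc (x i)) λ h → ¬q (λ j → ℤ.≰⇒> (λ r → h (j , r))))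
    where
    find : ∀ {n} {P : Fin n → Set} → (∀ j → Dec (P j)) → ¬ ¬ ∃ P → ∃ P
    find P? = Dec.decidable-stable (any? P?)

  _⟺_ : Set → Set → Set
  P ⟺ Q = (P → Q) × (Q → P)

  -- α t = λₜ(G) and β t = −ρₜ(G); the sign makes the two players' recursions identical.
  -- At t = −1 all values are integers, and they locate G among the integers.
  record Thermo (G : Game) : Set where
    field
      α β         : 𝔻 → 𝔻
      temp        : 𝔻 ₋
      α-wall      : Wall α
      β-wall      : Wall β
      α-lower     : ∃ λ x → ∀ t → x ≤ α t
      β-lower     : ∃ λ x → ∀ t → x ≤ β t
      b c         : ℤ
      α-b         : α -1𝔻 ≡ fromℤ b
      β-c         : β -1𝔻 ≡ fromℤ c
      ≤-b         : ∀ n → (b ℤ.≤ n) ⟺ (G ≤ᴳ integer n)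
      ≥-c         : ∀ n → (c ℤ.≤ ℤ.- n) ⟺ (integer n ≤ᴳ G)
  open Thermo

  -- the wall of a game from the opposite walls of its options
  module Side {m} (f : Fin (suc m) → 𝔻 → 𝔻) (W : ∀ i → Wall (f i)) where
    F : 𝔻 → 𝔻
    F t = maximum λ i → - f i t - t

    wall : Wall F
    wall = maximum-wall (λ i t → - f i t - t) (λ i → step-wall (W i))

    record AtMinus1 (c : Fin (suc m) → ℤ) : Set where
      field
        start : ℤ
        start-≡ : F -1𝔻 ≡ fromℤ start
        start-≤ : ∀ n → start ℤ.≤ n → ∀ i → ¬ c i ℤ.≤ ℤ.- n
        ≤-start : ∀ n → (∀ i → ¬ c i ℤ.≤ ℤ.- n) → start ℤ.≤ n
        above   : ∀ i → ℤ.suc (ℤ.- c i) ℤ.≤ start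

    at-1 : (c : Fin (suc m) → ℤ) → (∀ i → f i -1𝔻 ≡ fromℤ (c i)) → AtMinus1 c
    at-1 c e = record { start = bˢ ; start-≡ = trans (proj₂ att) (val i₀) ; start-≤ = to ; ≤-start = from ; above = above }
      where
      val : ∀ i → - f i -1𝔻 - -1𝔻 ≡ fromℤ (ℤ.suc (ℤ.- c i))
      val i = trans (cong (λ x → - x - -1𝔻) (e i)) (trans (cong (λ x → x - -1𝔻) (grid-neg 0 (c i)))
        (trans (grid-+ 0 (ℤ.- c i) 1ℤ) (cong fromℤ (ℤ.+-comm (ℤ.- c i) 1ℤ))))
      att = maximum-attained (λ i → - f i -1𝔻 - -1𝔻)
      i₀ = proj₁ att
      bˢ = ℤ.suc (ℤ.- c i₀)
      above : ∀ i → ℤ.suc (ℤ.- c i) ℤ.≤ bˢ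
      above i = grid-cancel 0 (≤-resp (sym (val i)) (sym (trans (proj₂ att) (val i₀))) (maximum-upper (λ i → - f i -1𝔻 - -1𝔻) i))
      to : ∀ n → bˢ ℤ.≤ n → ∀ i → ¬ c i ℤ.≤ ℤ.- n
      to n h i q = ℤ.<⇒≱ (ℤ.suc[i]≤j⇒i<j (ℤ.≤-trans (above i) h))
        (subst (λ x → x ℤ.≤ ℤ.- c i) (ℤ.neg-involutive n) (ℤ.neg-mono-≤ q))
      from : ∀ n → (∀ i → ¬ c i ℤ.≤ ℤ.- n) → bˢ ℤ.≤ n
      from n h = ℤ.i<j⇒suc[i]≤j (subst (λ x → ℤ.- c i₀ ℤ.< x) (ℤ.neg-involutive n) (ℤ.neg-mono-< (ℤ.≰⇒> (h i₀))))

    -- F is at most 0 wherever t dominates all the − f i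
    eventually : ∀ {t} → (∀ i → - f i t ≤ t) → F t ≤ 0𝔻
    eventually {t} h = maximum-lub (λ i → - f i t - t) λ i → lin₁ (h i)
      (solve 2 (λ x t → :0 :+ :- (x :+ :- t) := t :+ :- x) refl (value (- f i t)) (value t))

  record NonInteger {m n} (α : Fin (suc n) → 𝔻 → 𝔻) (β : Fin (suc m) → 𝔻 → 𝔻)
    (αG βG : 𝔻 → 𝔻) (temp : 𝔻 ₋) : Set where
    F : 𝔻 → 𝔻
    F t = maximum (λ i → - β i t - t)
    H : 𝔻 → 𝔻
    H t = maximum (λ j → - α j t - t)
    field
      τ        : 𝔻
      temp-τ   : temp ≡ Infimum.[ τ ]
      meet     : F τ ≡ - H τ
      earliest : ∀ s → F s ≤ - H s → τ ≤ s
      α-cut    : ∀ t → αG t ≡ F (t ⊓ τ)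
      β-cut    : ∀ t → βG t ≡ H (t ⊓ τ)

  integer-thermo : ∀ G n → G ≈ᴳ integer n → Thermo G
  integer-thermo G n (ge , le) = record
    { α = λ _ → fromℤ n
    ; β = λ _ → fromℤ (ℤ.- n)
    ; temp = ⊥₋
    ; α-wall = constant-wall n
    ; β-wall = constant-wall (ℤ.- n)
    ; α-lower = fromℤ n , λ _ → ≤-refl
    ; β-lower = fromℤ (ℤ.- n) , λ _ → ≤-refl
    ; b = n
    ; c = ℤ.- n
    ; α-b = refl
    ; β-c = refl
    ; ≤-b = λ k → (λ h → ≤ᴳ-trans {G} {integer n} {integer k} le (integer-mono h))
                , (λ h → integer-cancel (≤ᴳ-trans {integer n} {G} {integer k} ge h))
    ; ≥-c = λ k → (λ h → ≤ᴳ-trans {integer k} {integer n} {G} (integer-mono (ℤ.neg-cancel-≤ h)) ge)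
                , (λ h → ℤ.neg-mono-≤ (integer-cancel (≤ᴳ-trans {integer k} {G} {integer n} h le)))
    }

  module _ {m n} (L : Vector Game (suc m)) (R : Vector Game (suc n))
    (TL : ∀ i → Thermo (L i)) (TR : ∀ j → Thermo (R j))
    (¬G : ¬ IsInteger ⟨ L ∣ R ⟩) (i₀ : Fin (suc m)) (j₀ : Fin (suc n))
    (close : b (TR j₀) ℤ.≤ ℤ.suc (ℤ.- c (TL i₀))) where

    private
      G = ⟨ L ∣ R ⟩
      module FS = Side (λ i → β (TL i)) (λ i → β-wall (TL i))
      module HS = Side (λ j → α (TR j)) (λ j → α-wall (TR j))
      open FS using (F)
      H = HS.F

      abstract
        F-1 : FS.AtMinus1 (λ i → c (TL i))
        F-1 = FS.at-1 (λ i → c (TL i)) (λ i → β-c (TL i))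
        H-1 : HS.AtMinus1 (λ j → b (TR j))
        H-1 = HS.at-1 (λ j → b (TR j)) (λ j → α-b (TR j))
      module F-1 = FS.AtMinus1 F-1
      module H-1 = HS.AtMinus1 H-1
      bG cG : ℤ
      bG = F-1.start
      cG = H-1.start

      start : ¬ F -1𝔻 ≤ - H -1𝔻
      start h = ℤ.<⇒≱ {ℤ.- cG} {bG} lt
        (grid-cancel 0 (≤-resp (sym (F-1.start-≡)) (trans (sym (grid-neg 0 cG)) (sym (cong -_ (H-1.start-≡)))) h))
        where
        lt : ℤ.- cG ℤ.< bG
        lt = ℤ.<-≤-trans (ℤ.≤-<-trans (ℤ.neg-mono-≤ (H-1.above j₀))
                (subst (λ x → x ℤ.< b (TR j₀)) (flip-suc (b (TR j₀))) (ℤ.i≤pred[j]⇒i<j ℤ.≤-refl)))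
              (ℤ.≤-trans close (F-1.above i₀))
          where
          flip-suc : ∀ x → -1ℤ ℤ.+ x ≡ ℤ.- (1ℤ ℤ.+ (ℤ.- x))
          flip-suc = solve-∀

      TA = upper (λ i → - proj₁ (β-lower (TL i)))
      TB = upper (λ j → - proj₁ (α-lower (TR j)))
      T = proj₁ TA ℕ.⊔ proj₁ TB

      end : F (fromℤ (+ T)) ≤ - H (fromℤ (+ T))
      end = ≤-trans
        (FS.eventually λ i → ≤-trans (neg-antimono (proj₂ (β-lower (TL i)) (fromℤ (+ T))))
          (≤-trans (proj₂ TA i) (grid-mono 0 (ℤ.+≤+ (ℕ.m≤m⊔n (proj₁ TA) (proj₁ TB))))))
        (neg-antimono (HS.eventually λ j → ≤-trans (neg-antimono (proj₂ (α-lower (TR j)) (fromℤ (+ T))))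
          (≤-trans (proj₂ TB j) (grid-mono 0 (ℤ.+≤+ (ℕ.m≤n⊔m (proj₁ TA) (proj₁ TB)))))))

      cr = crossing FS.wall HS.wall start T end
      open Crossing cr renaming (j₀ to j₀ᶜ)

      -1≤τ : -1𝔻 ≤ τ
      -1≤τ = [ (λ h → h) , (λ h → contradiction
        (≤-trans (anti FS.wall h) (≤-trans (≤-reflexive meet) (neg-antimono (anti HS.wall h)))) start) ]′ (≤-total -1𝔻 τ)
        where open Wall

      αG βG : 𝔻 → 𝔻
      αG t = F (t ⊓ τ)
      βG t = H (t ⊓ τ)

      αG-wall : Wall αG
      αG-wall = cut-wall {f = F} k₀ j₀ᶜ FS.wall
      βG-wall : Wall βG
      βG-wall = cut-wall {f = H} k₀ j₀ᶜ HS.wall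

      αG-lower : ∃ λ x → ∀ t → x ≤ αG t
      αG-lower = F τ , λ t → Wall.anti FS.wall {t ⊓ τ} {τ} (Min.x⊓y≤y t τ)
      βG-lower : ∃ λ x → ∀ t → x ≤ βG t
      βG-lower = H τ , λ t → Wall.anti HS.wall {t ⊓ τ} {τ} (Min.x⊓y≤y t τ)

      αG-bG : αG -1𝔻 ≡ fromℤ bG
      αG-bG = trans (cong F (Min.x≤y⇒x⊓y≈x -1≤τ)) F-1.start-≡
      βG-cG : βG -1𝔻 ≡ fromℤ cG
      βG-cG = trans (cong H (Min.x≤y⇒x⊓y≈x -1≤τ)) H-1.start-≡

      ≤-bG : ∀ k → (bG ℤ.≤ k) ⟺ (G ≤ᴳ integer k)
      ≤-bG k = (λ h → noninteger-≤ G k ¬G λ i q → F-1.start-≤ k h i (proj₂ (≥-c (TL i) k) q))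
             , (λ h → F-1.≤-start k λ i q → ≤-left {G} {integer k} h i (proj₁ (≥-c (TL i) k) q))

      ≥-cG : ∀ k → (cG ℤ.≤ ℤ.- k) ⟺ (integer k ≤ᴳ G)
      ≥-cG k = (λ h → noninteger-≥ G k ¬G λ j q → H-1.start-≤ (ℤ.- k) h j
                       (subst (λ x → b (TR j) ℤ.≤ x) (sym (ℤ.neg-involutive k)) (proj₂ (≤-b (TR j) k) q)))
             , (λ h → H-1.≤-start (ℤ.- k) λ j q → ≤-right {integer k} {G} h j
                       (proj₁ (≤-b (TR j) k) (subst (λ x → b (TR j) ℤ.≤ x) (ℤ.neg-involutive k) q)))

    noninteger-thermo : Thermo G
    noninteger-thermo = record
      { α = αG ; β = βG ; temp = Infimum.[ τ ]
      ; α-wall = αG-wall ; β-wall = βG-wall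
      ; α-lower = αG-lower ; β-lower = βG-lower
      ; b = bG ; c = cG ; α-b = αG-bG ; β-c = βG-cG
      ; ≤-b = ≤-bG ; ≥-c = ≥-cG
      }

    noninteger-spec : NonInteger (λ j → α (TR j)) (λ i → β (TL i))
      (α noninteger-thermo) (β noninteger-thermo) (temp noninteger-thermo)
    noninteger-spec = record
      { τ = τ ; temp-τ = refl ; meet = meet ; earliest = earliest ; α-cut = λ _ → refl ; β-cut = λ _ → refl }

  data Spec {m n} (L : Vector Game m) (R : Vector Game n)
    (TL : ∀ i → Thermo (L i)) (TR : ∀ j → Thermo (R j)) : Thermo ⟨ L ∣ R ⟩ → Set where
    is-integer : ∀ k e → Spec L R TL TR (integer-thermo ⟨ L ∣ R ⟩ k e)
    non-integer : ∀ T → ¬ IsInteger ⟨ L ∣ R ⟩ → (m′ n′ : ℕ) (em : m ≡ suc m′) (en : n ≡ suc n′) →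
      NonInteger (λ j → α (TR (subst Fin (sym en) j))) (λ i → β (TL (subst Fin (sym em) i))) (α T) (β T) (temp T) →
      Spec L R TL TR T

  step : ∀ {m n} (L : Vector Game m) (R : Vector Game n) TL TR → ∃ (Spec L R TL TR)
  step {m} {n} L R TL TR = [ yes-case , no-case m n L R TL TR ]′ (between (λ i → ℤ.- c (TL i)) (λ j → b (TR j)))
    where
    yes-case : (∃ λ k → (∀ i → ℤ.- c (TL i) ℤ.< k) × (∀ j → k ℤ.< b (TR j))) → ∃ (Spec L R TL TR)
    yes-case (k , p , q) = integer-thermo ⟨ L ∣ R ⟩ _ (proj₂ s) , is-integer (proj₁ s) (proj₂ s)
      where
      s = simplicity ⟨ L ∣ R ⟩ k
        ( (λ i h → ℤ.<⇒≱ (p i) (subst (λ x → x ℤ.≤ ℤ.- c (TL i)) (ℤ.neg-involutive k) (ℤ.neg-mono-≤ (proj₂ (≥-c (TL i) k) h))))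
        , (λ j h → ℤ.<⇒≱ (q j) (proj₂ (≤-b (TR j) k) h)))

    no-case : ∀ m n (L : Vector Game m) (R : Vector Game n) (TL : ∀ i → Thermo (L i)) (TR : ∀ j → Thermo (R j)) →
      (∃₂ λ i j → b (TR j) ℤ.≤ ℤ.suc (ℤ.- c (TL i))) → ∃ (Spec L R TL TR)
    no-case (suc m) (suc n) L R TL TR (i , j , h) =
      noninteger-thermo L R TL TR ¬G i j h ,
      non-integer (noninteger-thermo L R TL TR ¬G i j h) ¬G m n refl refl (noninteger-spec L R TL TR ¬G i j h)
      where
      ¬G : ¬ IsInteger ⟨ L ∣ R ⟩
      ¬G (k , g) = ℤ.<⇒≱ (ℤ.≤-<-trans (ℤ.i<j⇒suc[i]≤j below) above) h
        where
        below : ℤ.- c (TL i) ℤ.< k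
        below = subst (λ x → ℤ.- c (TL i) ℤ.< x) (ℤ.neg-involutive k)
          (ℤ.neg-mono-< (ℤ.≰⇒> λ q → proj₁ (fits ⟨ L ∣ R ⟩ k g) i (proj₁ (≥-c (TL i) k) q)))
        above : k ℤ.< b (TR j)
        above = ℤ.≰⇒> λ q → proj₂ (fits ⟨ L ∣ R ⟩ k g) j (proj₁ (≤-b (TR j) k) q)

  thermo : ∀ G → Thermo G
  thermo ⟨ L ∣ R ⟩ = proj₁ (step L R (λ i → thermo (L i)) (λ j → thermo (R j)))

  spec : ∀ {m n} (L : Vector Game m) (R : Vector Game n) →
    Spec L R (λ i → thermo (L i)) (λ j → thermo (R j)) (thermo ⟨ L ∣ R ⟩)
  spec L R = proj₂ (step L R (λ i → thermo (L i)) (λ j → thermo (R j)))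

  open Thermo

  record Laws {G} (T : Thermo G) (λ̃ ρ̃ : 𝔻 → 𝔻 ±) : Set where
    field
      int-α    : ∀ {n} t → G ≈ᴳ integer n → α T t ≡ fromℤ n
      int-β    : ∀ {n} t → G ≈ᴳ integer n → - β T t ≡ fromℤ n
      int-temp : IsInteger G → temp T ≡ ⊥₋
      non-temp : ¬ IsInteger G → ∃ λ τ → temp T ≡ Infimum.[ τ ] × IsLeast (λ s → λ̃ s ≡ ρ̃ s) τ
      below-α  : ∀ {t τ} → temp T ≡ Infimum.[ τ ] → t ≤ τ → [ α T t ] ≡ λ̃ t
      below-β  : ∀ {t τ} → temp T ≡ Infimum.[ τ ] → t ≤ τ → [ - β T t ] ≡ ρ̃ t
      above-α  : ∀ {t τ} → temp T ≡ Infimum.[ τ ] → τ < t → α T t ≡ α T τ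
      above-β  : ∀ {t τ} → temp T ≡ Infimum.[ τ ] → τ < t → - β T t ≡ - β T τ

  laws : ∀ {m n} (L : Vector Game m) (R : Vector Game n) TL TR {T} → Spec L R TL TR T →
    Laws T (λ t → max λ i → - β (TL i) t - t) (λ t → min λ j → α (TR j) t + t)
  laws L R TL TR (is-integer k e@(k≤G , G≤k)) = record
    { int-α = λ _ g → cong fromℤ (same g)
    ; int-β = λ {n} _ g → trans (grid-neg 0 (ℤ.- k)) (cong fromℤ (trans (ℤ.neg-involutive k) (same g)))
    ; int-temp = λ _ → refl
    ; non-temp = λ ¬G → contradiction (k , e) ¬G
    ; below-α = λ ()
    ; below-β = λ ()
    ; above-α = λ ()
    ; above-β = λ ()
    }
    where
    G = ⟨ L ∣ R ⟩
    same : ∀ {n} → G ≈ᴳ integer n → k ≡ n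
    same {n} (n≤G , G≤n) = ℤ.≤-antisym
      (integer-cancel (≤ᴳ-trans {integer k} {G} {integer n} k≤G G≤n))
      (integer-cancel (≤ᴳ-trans {integer n} {G} {integer k} n≤G G≤k))
  laws L R TL TR (non-integer T ¬G m′ n′ refl refl N) = record
    { int-α = λ _ g → contradiction (_ , g) ¬G
    ; int-β = λ _ g → contradiction (_ , g) ¬G
    ; int-temp = λ g → contradiction g ¬G
    ; non-temp = λ _ → τ , temp-τ , record
        { holds = cong [_] (trans meet (sym (flipped τ)))
        ; least = λ s e → earliest s (≤-reflexive (trans ([]-injective e) (flipped s))) }
    ; below-α = λ {t} e h → cong [_] (trans (α-cut t) (cong F (Min.x≤y⇒x⊓y≈x (subst (λ x → t ≤ x) (sym (τ≡ e)) h))))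
    ; below-β = λ {t} e h → cong [_] (trans (cong -_ (trans (β-cut t) (cong H (Min.x≤y⇒x⊓y≈x (subst (λ x → t ≤ x) (sym (τ≡ e)) h))))) (sym (flipped t)))
    ; above-α = λ {t} {σ} e h → trans (α-cut t) (trans (cong F (eq e h)) (sym (α-cut σ)))
    ; above-β = λ {t} {σ} e h → cong -_ (trans (β-cut t) (trans (cong H (eq e h)) (sym (β-cut σ))))
    }
    where
    open NonInteger N
    flipped : ∀ s → minimum (λ j → α (TR j) s + s) ≡ - H s
    flipped s = minimum-flip (λ j → α (TR j) s + s) (λ j → - α (TR j) s - s) λ j → value-injective
      (solve 2 (λ a s → a :+ s := :- (:- a :+ :- s)) refl (value (α (TR j) s)) (value s))
    []-injective : ∀ {x y : 𝔻} → _≡_ {A = 𝔻 ±} [ x ] [ y ] → x ≡ y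
    []-injective refl = refl
    τ≡ : ∀ {σ} → temp T ≡ Infimum.[ σ ] → τ ≡ σ
    τ≡ e = inj (trans (sym temp-τ) e)
      where
      inj : ∀ {x y : 𝔻} → _≡_ {A = 𝔻 ₋} Infimum.[ x ] Infimum.[ y ] → x ≡ y
      inj refl = refl
    eq : ∀ {t σ} → temp T ≡ Infimum.[ σ ] → σ < t → t ⊓ τ ≡ σ ⊓ τ
    eq {t} {σ} e h = trans (Min.x≤y⇒y⊓x≈x (subst (λ x → x ≤ t) (sym (τ≡ e)) (<⇒≤ h)))
      (trans (τ≡ e) (sym (Min.x≤y⇒x⊓y≈x (≤-reflexive (sym (τ≡ e))))))

  Lawful : Game → Set
  Lawful G = Laws (thermo G) (λ t → max λ i → - β (thermo (left G i)) t - t) (λ t → min λ j → α (thermo (right G j)) t + t)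

  lawful : ∀ G → Lawful G
  lawful ⟨ L ∣ R ⟩ = laws L R (λ i → thermo (L i)) (λ j → thermo (R j)) (spec L R)

  abstract
    cooling : Cooling
    cooling = record
      { λₜ = λ t G → α (thermo G) t
      ; ρₜ = λ t G → - β (thermo G) t
      ; temperature = λ G → temp (thermo G)
      ; integer-λ = λ {G} → Laws.int-α (lawful G)
      ; integer-ρ = λ {G} → Laws.int-β (lawful G)
      ; integer-temperature = λ {G} → Laws.int-temp (lawful G)
      ; noninteger-temperature = λ {G} → Laws.non-temp (lawful G)
      ; below-λ = λ {G} → Laws.below-α (lawful G)
      ; below-ρ = λ {G} → Laws.below-β (lawful G)
      ; above-λ = λ {G} → Laws.above-α (lawful G)
      ; above-ρ = λ {G} → Laws.above-β (lawful G)
      }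

  open Cooling cooling using (temperature; λ̃ₜ; ρ̃ₜ)

  IsInteger? : ∀ G → Dec (IsInteger G)
  IsInteger? ⟨ L ∣ R ⟩ = decide (spec L R)
    where
    decide : ∀ {T} → Spec L R (λ i → thermo (L i)) (λ j → thermo (R j)) T → Dec (IsInteger ⟨ L ∣ R ⟩)
    decide (is-integer k e) = yes (k , e)
    decide (non-integer _ ¬G _ _ _ _ _) = no ¬G

  n<2^n : ∀ n → n ℕ.< 2 ℕ.^ n
  n<2^n zero = ℕ.≤-refl
  n<2^n (suc n) = ℕ.≤-trans (ℕ.+-mono-≤ (ℕ.m^n>0 2 n) (n<2^n n)) (ℕ.≤-reflexive (cong (λ x → 2 ℕ.^ n ℕ.+ x) (sym (ℕ.+-identityʳ (2 ℕ.^ n)))))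

  small : ∀ k δ → 0𝔻 < δ → ∃ λ d → grid (k ℕ.+ d) 1ℤ < δ
  small k δ (*<* 0<δ) = m , ≰⇒> λ { (*≤* h) → ℤ.<⇒≱ m<2^ (ℤ.≤-trans
      (ℤ.≤-trans (ℤ.≤-reflexive (sym (ℤ.*-identityˡ (+ (2 ℕ.^ (k ℕ.+ m))))))
        (ℤ.*-monoʳ-≤-nonNeg (+ (2 ℕ.^ (k ℕ.+ m))) 1≤n))
      (ℤ.≤-trans (/-≤⁻ (ℚ.↥ value δ) 1ℤ m (2 ℕ.^ (k ℕ.+ m)) {{_}} {{ℕ.m^n≢0 2 (k ℕ.+ m)}}
          (subst (λ x → x ℚ.≤ value (grid (k ℕ.+ m) 1ℤ)) (sym (ℚ.↥p/↧p≡p (value δ))) h))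
        (ℤ.≤-reflexive (ℤ.*-identityˡ (+ m))))) }
    where
    m = ℚ.↧ₙ (value δ)
    1≤n : 1ℤ ℤ.≤ ℚ.↥ value δ
    1≤n = ℤ.i<j⇒suc[i]≤j (subst (λ x → 0ℤ ℤ.< x) (ℤ.*-identityʳ (ℚ.↥ value δ)) (ℚ.drop-*<* 0<δ))
    m<2^ : + m ℤ.< + (2 ℕ.^ (k ℕ.+ m))
    m<2^ = ℤ.+<+ (ℕ.≤-trans (n<2^n m) (ℕ.^-monoʳ-≤ 2 (ℕ.m≤n+m m k)))

  grid-0 : ∀ k → grid k 0ℤ ≡ 0𝔻
  grid-0 k = sym (grid-refine 0 k 0ℤ)

  wall-constant? : ∀ {f} → Wall f → Dec (SlopeZeroBelow0 f)
  wall-constant? {f} W = decide (Wall.pieces W {k} ℕ.≤-refl -1ℤ)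
    where
    k = Wall.level W
    zero-cell : Cell k -1ℤ 0𝔻
    zero-cell = ≤-resp refl (sym (grid-0 k)) (grid-mono k {i = -1ℤ} {j = 0ℤ} ℤ.-≤+) , ≤-reflexive (sym (grid-0 k))

    decide : Piece f k -1ℤ → Dec (SlopeZeroBelow0 f)
    decide (flat w p) = yes (grid k 1ℤ
      , ≰⇒> (λ h → ℤ.<⇒≱ {0ℤ} {1ℤ} (ℤ.+<+ (ℕ.s≤s ℕ.z≤n)) (grid-cancel k (≤-trans h (≤-reflexive (sym (grid-0 k))))))
      , λ s l r → trans (p (≤-trans (≤-reflexive (sym (grid-neg k 1ℤ))) (<⇒≤ l) , ≤-trans r (≤-reflexive (sym (grid-0 k)))))
                        (sym (p zero-cell)))
    decide (fall w p) = no λ (δ , 0<δ , h) → contra δ h (small k δ 0<δ)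
      where
      contra : ∀ δ → (∀ s → - δ < s → s ≤ 0𝔻 → f s ≡ f 0𝔻) → (∃ λ d → grid (k ℕ.+ d) 1ℤ < δ) → ⊥
      contra δ h (d , lt) = ℤ.<⇒≱ {x = -1ℤ} {y = 0ℤ} ℤ.-<+ (grid-cancel (k ℕ.+ d)
        (≤-trans (≤-reflexive (grid-0 (k ℕ.+ d))) (lin₁ (≤-reflexive (trans (sym (p cell)) (trans (h s -δ<s s≤0) (p zero-cell))))
          (solve 3 (λ s z w → s :+ :- z := (w :+ :- z) :+ :- (w :+ :- s)) refl (value s) (value 0𝔻) (value (grid k w))))))
        where
        s = grid (k ℕ.+ d) -1ℤ
        -δ<s : - δ < s
        -δ<s = ≰⇒> λ q → <⇒≱ lt (lin₁ (≤-trans (≤-reflexive (grid-neg (k ℕ.+ d) 1ℤ)) q)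
          (solve 2 (λ g δ → g :+ :- δ := :- δ :+ :- (:- g)) refl (value (grid (k ℕ.+ d) 1ℤ)) (value δ)))
        s≤0 : s ≤ 0𝔻
        s≤0 = ≤-trans (grid-mono (k ℕ.+ d) {i = -1ℤ} {j = 0ℤ} ℤ.-≤+) (≤-reflexive (grid-0 (k ℕ.+ d)))
        cell : Cell k -1ℤ s
        cell = ≤-trans (≤-reflexive (grid-refine k d -1ℤ)) (grid-mono (k ℕ.+ d) (ℤ.≤-trans
                 (ℤ.≤-reflexive (ℤ.-1*i≡-i (+ (2 ℕ.^ d)))) (ℤ.neg-mono-≤ (ℤ.+≤+ (ℕ.m^n>0 2 d)))))
             , ≤-trans s≤0 (≤-reflexive (sym (grid-0 k)))

  constant-map : ∀ {A B : Set} {f : 𝔻 → A} {g : 𝔻 → B} → (∀ s t → f s ≡ f t → g s ≡ g t) → SlopeZeroBelow0 f → SlopeZeroBelow0 g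
  constant-map e (δ , 0<δ , h) = δ , 0<δ , λ s l r → e s 0𝔻 (h s l r)

  abstract
    λ̃-constant? : ∀ G → Dec (SlopeZeroBelow0 (λ s → λ̃ₜ s G))
    λ̃-constant? (⟨_∣_⟩ {zero} L R) = yes (fromℤ 1ℤ , *<* (ℚ.*<* (ℤ.+<+ (ℕ.s≤s ℕ.z≤n))) , λ _ _ _ → refl)
    λ̃-constant? (⟨_∣_⟩ {suc m} L R) = Dec.map′
      (constant-map λ s t e → cong [_] e)
      (constant-map λ s t e → []-inj e)
      (wall-constant? (Side.wall (λ i → β (thermo (L i))) (λ i → β-wall (thermo (L i)))))
      where
      []-inj : ∀ {x y : 𝔻} → _≡_ {A = 𝔻 ±} [ x ] [ y ] → x ≡ y
      []-inj refl = refl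

    ρ̃-constant? : ∀ G → Dec (SlopeZeroBelow0 (λ s → ρ̃ₜ s G))
    ρ̃-constant? (⟨_∣_⟩ {_} {zero} L R) = yes (fromℤ 1ℤ , *<* (ℚ.*<* (ℤ.+<+ (ℕ.s≤s ℕ.z≤n))) , λ _ _ _ → refl)
    ρ̃-constant? (⟨_∣_⟩ {_} {suc n} L R) = Dec.map′
      (constant-map λ s t e → cong [_] (trans (flipped s) (trans (cong -_ e) (sym (flipped t)))))
      (constant-map λ s t e → neg-inj (trans (sym (flipped s)) (trans ([]-inj e) (flipped t))))
      (wall-constant? (Side.wall (λ j → α (thermo (R j))) (λ j → α-wall (thermo (R j)))))
      where
      H : 𝔻 → 𝔻
      H = Side.F (λ j → α (thermo (R j))) (λ j → α-wall (thermo (R j)))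
      []-inj : ∀ {x y : 𝔻} → _≡_ {A = 𝔻 ±} [ x ] [ y ] → x ≡ y
      []-inj refl = refl
      neg-inj : ∀ {x y} → - x ≡ - y → x ≡ y
      neg-inj e = value-injective (ℚ.neg-injective (cong value e))
      flipped : ∀ s → minimum (λ j → α (thermo (R j)) s + s) ≡ - H s
      flipped s = minimum-flip (λ j → α (thermo (R j)) s + s) (λ j → - α (thermo (R j)) s - s) λ j → value-injective
        (solve 2 (λ a s → a :+ s := :- (:- a :+ :- s)) refl (value (α (thermo (R j)) s)) (value s))

open Construction public using (cooling)
open Construction using (IsInteger?; λ̃-constant?; ρ̃-constant?)
open Cooling cooling public

------------------------------------------------------------------------
-- The simplest-integer criterion

M m : Game → 𝔻 ±
M G = max (λ i → ρₜ 0𝔻 (left G i))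
m G = min (λ j → λₜ 0𝔻 (right G j))

EqualsM StopsFlatAtM : (G : Game) → Fin (#ᴸ G) → Set
EqualsM G i = ∃ λ n → M G ≡ [ fromℤ n ] × left G i ≈ᴳ integer n
StopsFlatAtM G i = ∃ λ n → M G ≡ [ fromℤ n ]
  × ρₜ 0𝔻 (left G i) ≡ fromℤ n
  × ¬ IsInteger (left G i)
  × SlopeZeroBelow0 (λ s → ρ̃ₜ s (left G i))

Equalsm StopsFlatAtm : (G : Game) → Fin (#ᴿ G) → Set
Equalsm G j = ∃ λ n → m G ≡ [ fromℤ n ] × right G j ≈ᴳ integer n
StopsFlatAtm G j = ∃ λ n → m G ≡ [ fromℤ n ]
  × λₜ 0𝔻 (right G j) ≡ fromℤ n
  × ¬ IsInteger (right G j)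
  × SlopeZeroBelow0 (λ s → λ̃ₜ s (right G j))

_≟𝔻_ : (x y : 𝔻) → Dec (x ≡ y)
x ≟𝔻 y = Dec.map′ value-injective (cong value) (value x ℚ.≟ value y)

_≈ᴳ?_ : ∀ G H → Dec (G ≈ᴳ H)
G ≈ᴳ? H = (H ≤ᴳ? G) ×-dec (G ≤ᴳ? H)

private
  fromℤ-numerator : ∀ n → ℚ.↥ (value (fromℤ n)) ≡ n
  fromℤ-numerator n = cong ℚ.↥_ (ℚ.↥p/↧p≡p (ℚ.fromℤ n))

integral? : ∀ x {P : ℤ → Set} → (∀ n → Dec (P n)) → Dec (∃ λ n → x ≡ [ fromℤ n ] × P n)
integral? ⊥±    P? = no λ ()
integral? ⊤±    P? = no λ ()
integral? [ x ] {P} P? = Dec.map′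
  (λ (e , p) → ℚ.↥ (value x) , cong [_] e , p)
  (λ { (n , refl , p) → let e = sym (fromℤ-numerator n) in cong fromℤ e , subst P e p })
  ((x ≟𝔻 fromℤ (ℚ.↥ (value x))) ×-dec P? (ℚ.↥ (value x)))

raises? : ∀ G i → Dec (EqualsM G i ⊎ StopsFlatAtM G i)
raises? G i =
  integral? (M G) (λ n → left G i ≈ᴳ? integer n) ⊎-dec
  integral? (M G) (λ n → (ρₜ 0𝔻 (left G i) ≟𝔻 fromℤ n) ×-dec (¬? (IsInteger? (left G i)) ×-dec ρ̃-constant? (left G i)))

lowers? : ∀ G j → Dec (Equalsm G j ⊎ StopsFlatAtm G j)
lowers? G j =
  integral? (m G) (λ n → right G j ≈ᴳ? integer n) ⊎-dec
  integral? (m G) (λ n → (λₜ 0𝔻 (right G j) ≟𝔻 fromℤ n) ×-dec (¬? (IsInteger? (right G j)) ×-dec λ̃-constant? (right G j)))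

_+±_ : 𝔻 ± → 𝔻 → 𝔻 ±
⊥±    +± d = ⊥±
[ x ] +± d = [ x + d ]
⊤±    +± d = ⊤±

l r : Game → 𝔻 ±
l G = if does (any? (raises? G)) then M G +± fromℤ 1ℤ else M G
r G = if does (any? (lowers? G)) then m G +± fromℤ -1ℤ else m G

open Extrema _≤_ using (_≤±_)

S : Game → Pred ℤ _
S G n = l G ≤± [ fromℤ n ] × [ fromℤ n ] ≤± r G

HasLeastAbs : Pred ℤ _ → ℤ → Set
HasLeastAbs P n = P n × (∀ k → P k → ℤ.∣ n ∣ ℕ.≤ ℤ.∣ k ∣)

{-# OPTIONS --safe #-}
module Submission where

-- At t = −1 the stops are integers: ρ₋₁(H) = ⌊ H ⌋ is the largest integer ≤ H, and
-- λ₋₁(H) = ⌈ H ⌉ is the smallest integer ≥ H. By the simplicity theorem G is an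
-- integer iff some integer n satisfies ⌊ Gᴸ ⌋ < n < ⌈ Gᴿ ⌉ for all options, and then
-- it is the one of least absolute value. It remains to see that l ≤ n says
-- ⌊ Gᴸ ⌋ < n for all Gᴸ. Since ρₜ has slopes 0 and 1, ⌊ Gᴸ ⌋ ≤ ρ₀(Gᴸ) ≤ ⌊ Gᴸ ⌋ + 1,
-- so ρ₀(Gᴸ) ≤ n is the same condition as ⌊ Gᴸ ⌋ < n unless ρ₀(Gᴸ) = ⌊ Gᴸ ⌋ = n, that is,
-- unless ρ₀(Gᴸ) = n and ρₜ is flat just below 0. This is where M is raised by 1.

open import Defs
open import Data.Bool using (if_then_else_)
open import Data.Fin using (zero; suc)
open import Data.Fin.Properties using (any?)
open import Data.Integer as ℤ using (ℤ; +_; -[1+_]; 0ℤ; 1ℤ; -1ℤ)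
import Data.Integer.Properties as ℤ
open import Data.Nat as ℕ using (zero; suc)
import Data.Nat.Properties as ℕ
open import Data.Product using (∃; _×_; _,_; proj₁; proj₂)
import Data.Rational.Properties as ℚ
open import Data.Sum using (_⊎_; inj₁; inj₂; [_,_]′)
open import Data.Vec.Functional using (Vector)
open import Function using (_∘_)
import Relation.Binary.Construct.Add.Extrema.NonStrict as Extrema
open import Relation.Binary.PropositionalEquality hiding ([_])
open import Relation.Nullary using (¬_; Dec; yes; no; does; contradiction)
open import Relation.Nullary.Construct.Add.Extrema using ([_]; [_]-injective)
import Relation.Nullary.Construct.Add.Infimum as Infimum
open import Relation.Unary using (Empty)

open Construction using
  (Thermo; thermo; Wall; -1𝔻; Laws; lawful; IsInteger?; small; grid-0; ≤-resp; neg-antimono;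
   maximum-upper; maximum-lub; _⟺_)
import Algebra.Construct.NaturalChoice.Min 𝔻-totalOrder as Min
open Extrema _≤_ using (_≤±_; ⊥±≤_; _≤⊤±; [≤]-injective) renaming ([_] to [_]≤±)
open Thermo
open Wall

-- Walls on the interval [-1 , 0]

fromℤ-injective : ∀ {i j} → fromℤ i ≡ fromℤ j → i ≡ j
fromℤ-injective e = ℤ.≤-antisym (fromℤ-cancel (≤-reflexive e)) (fromℤ-cancel (≤-reflexive (sym e)))

-‿involutive : ∀ x → - - x ≡ x
-‿involutive x = value-injective (solve 1 (λ x → :- (:- x) := x) refl (value x))

-1≤0 : -1𝔻 ≤ 0𝔻
-1≤0 = grid-mono 0 { -1ℤ} {0ℤ} ℤ.-≤+

fromℤ-shift : ∀ d n → fromℤ n + fromℤ d ≡ fromℤ (d ℤ.+ n)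
fromℤ-shift d n = trans (grid-+ 0 n d) (cong fromℤ (ℤ.+-comm n d))

+-monoˡ-≤ : ∀ z {x y} → x ≤ y → x + z ≤ y + z
+-monoˡ-≤ z {x} {y} h = lin₁ h (solve 3 (λ x y z → (y :+ z) :+ :- (x :+ z) := y :+ :- x) refl (value x) (value y) (value z))

-- Since `f t + t` never decreases, `f` falls by at most 1 along [-1 , 0].
wall-drop : ∀ {f} b → Wall f → f -1𝔻 ≡ fromℤ b → fromℤ (ℤ.pred b) ≤ f 0𝔻
wall-drop {f} b W e = ≤-resp (trans (sym (fromℤ-shift -1ℤ b)) (cong (_+ -1𝔻) (sym e))) refl
  (≤-trans (slow W -1≤0) (≤-reflexive (value-injective (ℚ.+-identityʳ _))))

-- A wall drops by less than 1 on [−1 , 0] if it is constant just below 0, so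
-- between two integers it does not drop at all.
wall-flat : ∀ {f b n} → Wall f → f -1𝔻 ≡ fromℤ b → f 0𝔻 ≡ fromℤ n → SlopeZeroBelow0 f → b ≡ n
wall-flat {f} {b} {n} W e e₀ (δ , 0<δ , h) = ℤ.≤-antisym (ℤ.≮⇒≥ n≮b)
  (fromℤ-cancel (≤-resp (sym e₀) (sym e) (anti W -1≤0)))
  where
  -- The sample point s = -1/2ᵈ lies in (-δ , 0], where `f` still has its value at 0.
  d = proj₁ (small 0 δ 0<δ)
  s = grid d -1ℤ
  -δ<s : - δ < s
  -δ<s = ≰⇒> λ q → <⇒≱ (proj₂ (small 0 δ 0<δ)) (lin₁ (≤-trans (≤-reflexive (grid-neg d 1ℤ)) q)
    (solve 2 (λ g δ → g :+ :- δ := :- δ :+ :- (:- g)) refl (value (grid d 1ℤ)) (value δ)))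
  s≤0 : s ≤ 0𝔻
  s≤0 = ≤-trans (grid-mono d { -1ℤ} {0ℤ} ℤ.-≤+) (≤-reflexive (grid-0 d))
  -1≤s : -1𝔻 ≤ s
  -1≤s = ≤-trans (≤-reflexive (grid-refine 0 d -1ℤ)) (grid-mono d (ℤ.≤-trans
    (ℤ.≤-reflexive (ℤ.-1*i≡-i (+ (2 ℕ.^ d)))) (ℤ.neg-mono-≤ (ℤ.+≤+ (ℕ.m^n>0 2 d)))))
  n≮b : ¬ n ℤ.< b
  -- If n + 1 ≤ b, then a slope of at least -1 on [-1 , s] gives b - 1 ≤ n + s, hence 0 ≤ s,
  -- although s = -1/2ᵈ.
  n≮b n<b = ℤ.<⇒≱ { -1ℤ} {0ℤ} ℤ.-<+ (grid-cancel d (≤-trans (≤-reflexive (grid-0 d)) 0≤s))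
    where
    n+1≤b : fromℤ n + fromℤ 1ℤ ≤ fromℤ b
    n+1≤b = ≤-trans (≤-reflexive (fromℤ-shift 1ℤ n)) (grid-mono 0 (ℤ.i<j⇒suc[i]≤j n<b))
    b-1≤n+s : fromℤ b - fromℤ 1ℤ ≤ fromℤ n + s
    b-1≤n+s = ≤-resp (cong (_+ -1𝔻) (sym e)) (cong (_+ s) (sym (trans (h s -δ<s s≤0) e₀))) (slow W -1≤s)
    0≤s : 0𝔻 ≤ s
    0≤s = lin₂ n+1≤b b-1≤n+s
      (solve 4 (λ n b s u → s :+ :- :0 := (b :+ :- (n :+ u)) :+ ((n :+ s) :+ :- (b :+ :- u)))
        refl (value (fromℤ n)) (value (fromℤ b)) (value s) (value (fromℤ 1ℤ)))

-- An antitone function with equal values at both ends is constant in between, so δ = 1 works.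
wall-flat⁻¹ : ∀ {f} → Wall f → f -1𝔻 ≡ f 0𝔻 → SlopeZeroBelow0 f
wall-flat⁻¹ W e = fromℤ 1ℤ , ≰⇒> (λ h → ℤ.<⇒≱ {0ℤ} {1ℤ} (ℤ.+<+ (ℕ.s≤s ℕ.z≤n)) (fromℤ-cancel {1ℤ} {0ℤ} h)) ,
  λ s l u → ≤-antisym (≤-trans (anti W (<⇒≤ l)) (≤-reflexive e)) (anti W u)

-- Extrema of finite families

max-cong : ∀ {n} {v w : Vector 𝔻 n} → (∀ i → v i ≡ w i) → max v ≡ max w
max-cong {zero} e = refl
max-cong {suc n} e = cong [_] (go e)
  where
  go : ∀ {n} {v w : Vector 𝔻 (suc n)} → (∀ i → v i ≡ w i) → maximum v ≡ maximum w
  go {zero} e = e zero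
  go {suc n} e = cong₂ _⊔_ (e zero) (go (e ∘ suc))

min-cong : ∀ {n} {v w : Vector 𝔻 n} → (∀ i → v i ≡ w i) → min v ≡ min w
min-cong {zero} e = refl
min-cong {suc n} e = cong [_] (go e)
  where
  go : ∀ {n} {v w : Vector 𝔻 (suc n)} → (∀ i → v i ≡ w i) → minimum v ≡ minimum w
  go {zero} e = e zero
  go {suc n} e = cong₂ _⊓_ (e zero) (go (e ∘ suc))

-- The index `i` excludes the empty family, so the maximum is finite and can be named `x`.
max-upper : ∀ {n} (v : Vector 𝔻 n) i → ∃ λ x → max v ≡ [ x ] × v i ≤ x
max-upper {suc n} v i = maximum v , refl , maximum-upper v i

max-lub : ∀ {n} (v : Vector 𝔻 n) {x} → (∀ i → v i ≤ x) → max v ≤± [ x ]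
max-lub {zero} v h = ⊥±≤ _
max-lub {suc n} v h = [ maximum-lub v h ]≤±

minimum-lower : ∀ {n} (v : Vector 𝔻 (suc n)) i → minimum v ≤ v i
minimum-lower {zero}  v zero = ≤-refl
minimum-lower {suc n} v zero = Min.x⊓y≤x (v zero) (minimum (v ∘ suc))
minimum-lower {suc n} v (suc i) = ≤-trans (Min.x⊓y≤y (v zero) (minimum (v ∘ suc))) (minimum-lower (v ∘ suc) i)

minimum-glb : ∀ {n} (v : Vector 𝔻 (suc n)) {x} → (∀ i → x ≤ v i) → x ≤ minimum v
minimum-glb {zero} v h = h zero
minimum-glb {suc n} v h = Min.⊓-glb (h zero) (minimum-glb (v ∘ suc) (h ∘ suc))

min-lower : ∀ {n} (v : Vector 𝔻 n) i → ∃ λ x → min v ≡ [ x ] × x ≤ v i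
min-lower {suc n} v i = minimum v , refl , minimum-lower v i

min-glb : ∀ {n} (v : Vector 𝔻 n) {x} → (∀ i → x ≤ v i) → [ x ] ≤± min v
min-glb {zero} v h = _ ≤⊤±
min-glb {suc n} v h = [ minimum-glb v h ]≤±

-- Uniqueness of the cooling functions

-- The recursion for λₜ and ρₜ has only one solution, hence the abstract
-- solution is the one given by the thermographs.
unique : ∀ G → (∀ t → λₜ t G ≡ α (thermo G) t) × (∀ t → ρₜ t G ≡ - β (thermo G) t)
unique G@(⟨ L ∣ R ⟩) with IsInteger? G
... | yes (n , e) = (λ t → trans (integer-λ t e) (sym (Laws.int-α (lawful G) t e)))
                  , (λ t → trans (integer-ρ t e) (sym (Laws.int-β (lawful G) t e)))
... | no ¬G with noninteger-temperature ¬G | Laws.non-temp (lawful G) ¬G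
...   | τ , eτ , P | σ , eσ , Q = uα , uβ
  where
  λ̃-agree : ∀ s → λ̃ₜ s G ≡ max (λ i → - β (thermo (L i)) s - s)
  λ̃-agree s = max-cong λ i → cong (_- s) (proj₂ (unique (L i)) s)
  ρ̃-agree : ∀ s → ρ̃ₜ s G ≡ min (λ j → α (thermo (R j)) s + s)
  ρ̃-agree s = min-cong λ j → cong (_+ s) (proj₁ (unique (R j)) s)
  -- By induction the options agree, so both temperatures are the least solution of the same
  -- equation.
  τ≡σ : τ ≡ σ
  τ≡σ = ≤-antisym
    (IsLeast.least P σ (trans (λ̃-agree σ) (trans (IsLeast.holds Q) (sym (ρ̃-agree σ)))))
    (IsLeast.least Q τ (trans (sym (λ̃-agree τ)) (trans (IsLeast.holds P) (ρ̃-agree τ))))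
  eτ′ : temp (thermo G) ≡ Infimum.[ τ ]
  eτ′ = trans eσ (cong Infimum.[_] (sym τ≡σ))
  belowα : ∀ {t} → t ≤ τ → λₜ t G ≡ α (thermo G) t
  belowα {t} h = [_]-injective (trans (below-λ eτ h) (trans (λ̃-agree t) (sym (Laws.below-α (lawful G) eτ′ h))))
  belowβ : ∀ {t} → t ≤ τ → ρₜ t G ≡ - β (thermo G) t
  belowβ {t} h = [_]-injective (trans (below-ρ eτ h) (trans (ρ̃-agree t) (sym (Laws.below-β (lawful G) eτ′ h))))
  uα : ∀ t → λₜ t G ≡ α (thermo G) t
  uα t with t ≤? τ
  ... | yes h = belowα h
  ... | no ¬h = trans (above-λ eτ (≰⇒> ¬h)) (trans (belowα ≤-refl) (sym (Laws.above-α (lawful G) eτ′ (≰⇒> ¬h))))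
  uβ : ∀ t → ρₜ t G ≡ - β (thermo G) t
  uβ t with t ≤? τ
  ... | yes h = belowβ h
  ... | no ¬h = trans (above-ρ eτ (≰⇒> ¬h)) (trans (belowβ ≤-refl) (sym (Laws.above-β (lawful G) eτ′ (≰⇒> ¬h))))

-- Floor and ceiling of a game

⌊_⌋ ⌈_⌉ : Game → ℤ
⌊ G ⌋ = ℤ.- c (thermo G)
⌈ G ⌉ = b (thermo G)

≤⌊⌋ : ∀ G n → (n ℤ.≤ ⌊ G ⌋) ⟺ (integer n ≤ᴳ G)
≤⌊⌋ G n = (λ h → proj₁ (≥-c (thermo G) n) (subst (ℤ._≤ ℤ.- n) (ℤ.neg-involutive (c (thermo G))) (ℤ.neg-mono-≤ h)))
        , (λ h → subst (ℤ._≤ ⌊ G ⌋) (ℤ.neg-involutive n) (ℤ.neg-mono-≤ (proj₂ (≥-c (thermo G) n) h)))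

⌈⌉≤ : ∀ G n → (⌈ G ⌉ ℤ.≤ n) ⟺ (G ≤ᴳ integer n)
⌈⌉≤ G = ≤-b (thermo G)

-ρ : ∀ G t → β (thermo G) t ≡ - ρₜ t G
-ρ G t = sym (trans (cong -_ (proj₂ (unique G) t)) (-‿involutive (β (thermo G) t)))

λ₋₁ : ∀ G → λₜ -1𝔻 G ≡ fromℤ ⌈ G ⌉
λ₋₁ G = trans (proj₁ (unique G) -1𝔻) (α-b (thermo G))

ρ₋₁ : ∀ G → ρₜ -1𝔻 G ≡ fromℤ ⌊ G ⌋
ρ₋₁ G = trans (proj₂ (unique G) -1𝔻) (trans (cong -_ (β-c (thermo G))) (grid-neg 0 (c (thermo G))))

⌊⌋-integer : ∀ {G n} → G ≈ᴳ integer n → ⌊ G ⌋ ≡ n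
⌊⌋-integer {G} {n} e = fromℤ-injective {⌊ G ⌋} {n} (trans (sym (ρ₋₁ G)) (integer-ρ -1𝔻 e))

⌈⌉-integer : ∀ {G n} → G ≈ᴳ integer n → ⌈ G ⌉ ≡ n
⌈⌉-integer {G} {n} e = fromℤ-injective {⌈ G ⌉} {n} (trans (sym (λ₋₁ G)) (integer-λ -1𝔻 e))

-- As `β` is -ρₜ, its antitonicity makes ρₜ nondecreasing from -1 to 0.
⌊⌋≤ρ₀ : ∀ G → fromℤ ⌊ G ⌋ ≤ ρₜ 0𝔻 G
⌊⌋≤ρ₀ G = ≤-resp (sym (ρ₋₁ G)) refl (≤-resp (proj₂ (unique G) -1𝔻) (proj₂ (unique G) 0𝔻)
  (neg-antimono {β (thermo G) 0𝔻} {β (thermo G) -1𝔻} (anti (β-wall (thermo G)) -1≤0)))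

ρ₀≤suc⌊⌋ : ∀ G → ρₜ 0𝔻 G ≤ fromℤ (ℤ.suc ⌊ G ⌋)
ρ₀≤suc⌊⌋ G = ≤-resp (proj₂ (unique G) 0𝔻)
  (trans (cong fromℤ (sym (ℤ.neg-distrib-+ -1ℤ (c (thermo G))))) (sym (grid-neg 0 (ℤ.pred (c (thermo G))))))
  (neg-antimono {fromℤ (ℤ.pred (c (thermo G)))} {β (thermo G) 0𝔻} (wall-drop (c (thermo G)) (β-wall (thermo G)) (β-c (thermo G))))

λ₀≤⌈⌉ : ∀ G → λₜ 0𝔻 G ≤ fromℤ ⌈ G ⌉
λ₀≤⌈⌉ G = ≤-resp (proj₁ (unique G) 0𝔻) (sym (α-b (thermo G))) (anti (α-wall (thermo G)) -1≤0)

pred⌈⌉≤λ₀ : ∀ G → fromℤ (ℤ.pred ⌈ G ⌉) ≤ λₜ 0𝔻 G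
pred⌈⌉≤λ₀ G = ≤-resp refl (proj₁ (unique G) 0𝔻) (wall-drop ⌈ G ⌉ (α-wall (thermo G)) (α-b (thermo G)))

-- The ceiling and λ₀ are the values of the wall `α` at -1 and 0, so `wall-flat` applies.
λ-flat : ∀ G {n} → λₜ 0𝔻 G ≡ fromℤ n → SlopeZeroBelow0 (λ s → λₜ s G) → ⌈ G ⌉ ≡ n
λ-flat G e (δ , 0<δ , h) = wall-flat (α-wall (thermo G)) (α-b (thermo G)) (trans (sym (proj₁ (unique G) 0𝔻)) e)
  (δ , 0<δ , λ s p q → trans (sym (proj₁ (unique G) s)) (trans (h s p q) (proj₁ (unique G) 0𝔻)))

ρ-flat : ∀ G {n} → ρₜ 0𝔻 G ≡ fromℤ n → SlopeZeroBelow0 (λ s → ρₜ s G) → ⌊ G ⌋ ≡ n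
ρ-flat G {n} e (δ , 0<δ , h) = trans (cong ℤ.-_ (wall-flat (β-wall (thermo G)) (β-c (thermo G))
    (trans (-ρ G 0𝔻) (trans (cong -_ e) (grid-neg 0 n)))
    (δ , 0<δ , λ s p q → trans (-ρ G s) (trans (cong -_ (h s p q)) (sym (-ρ G 0𝔻))))))
  (ℤ.neg-involutive n)

λ-flat⁻¹ : ∀ G {n} → λₜ 0𝔻 G ≡ fromℤ n → ⌈ G ⌉ ≡ n → SlopeZeroBelow0 (λ s → λₜ s G)
λ-flat⁻¹ G e refl =
  let (δ , 0<δ , h) = wall-flat⁻¹ (α-wall (thermo G)) (trans (α-b (thermo G)) (trans (sym e) (proj₁ (unique G) 0𝔻)))
  in δ , 0<δ , λ s p q → trans (proj₁ (unique G) s) (trans (h s p q) (sym (proj₁ (unique G) 0𝔻)))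

ρ-flat⁻¹ : ∀ G {n} → ρₜ 0𝔻 G ≡ fromℤ n → ⌊ G ⌋ ≡ n → SlopeZeroBelow0 (λ s → ρₜ s G)
ρ-flat⁻¹ G e refl =
  let (δ , 0<δ , h) = wall-flat⁻¹ (β-wall (thermo G)) (trans (-ρ G -1𝔻) (trans (cong -_ (trans (ρ₋₁ G) (sym e))) (sym (-ρ G 0𝔻))))
  in δ , 0<δ , λ s p q → trans (proj₂ (unique G) s) (trans (cong -_ (h s p q)) (sym (proj₂ (unique G) 0𝔻)))

-- Slopes just below 0 and conditions (i) to (iv)

-- At a negative temperature both stops are constant on (t(G) , 0]; were they the
-- integer n, then ⌊ G ⌋ = ⌈ G ⌉ = n.
integral-stop⇒0≤temperature : ∀ {G τ n} → ¬ IsInteger G → temperature G ≡ Infimum.[ τ ] →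
  λₜ 0𝔻 G ≡ fromℤ n ⊎ ρₜ 0𝔻 G ≡ fromℤ n → 0𝔻 ≤ τ
integral-stop⇒0≤temperature {G} {τ} {n} ¬G eτ stop with 0𝔻 ≤? τ
... | yes h = h
... | no ¬h = contradiction
  (n , proj₁ (≤⌊⌋ G n) (ℤ.≤-reflexive (sym (ρ-flat G eρ (flat above-ρ′)))) ,
       proj₁ (⌈⌉≤ G n) (ℤ.≤-reflexive (λ-flat G eλ (flat above-λ′)))) ¬G
  where
  τ<0 : τ < 0𝔻
  τ<0 = ≰⇒> ¬h
  above-λ′ : ∀ {s} → τ < s → λₜ s G ≡ λₜ τ G
  above-λ′ = above-λ eτ
  above-ρ′ : ∀ {s} → τ < s → ρₜ s G ≡ ρₜ τ G
  above-ρ′ = above-ρ eτ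
  λτ≡ρτ : λₜ τ G ≡ ρₜ τ G
  λτ≡ρτ with noninteger-temperature ¬G
  ... | σ , eσ , P with refl ← trans (sym eτ) eσ =
    [_]-injective (trans (below-λ eτ ≤-refl) (trans (IsLeast.holds P) (sym (below-ρ eτ ≤-refl))))
  -- Above the temperature the two stops coincide, so if either one is n at 0, both are.
  λ₀≡ρ₀ : λₜ 0𝔻 G ≡ ρₜ 0𝔻 G
  λ₀≡ρ₀ = trans (above-λ′ τ<0) (trans λτ≡ρτ (sym (above-ρ′ τ<0)))
  eλ : λₜ 0𝔻 G ≡ fromℤ n
  eλ = [ (λ e → e) , trans λ₀≡ρ₀ ]′ stop
  eρ : ρₜ 0𝔻 G ≡ fromℤ n
  eρ = trans (sym λ₀≡ρ₀) eλ
  0<-τ : 0𝔻 < - τ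
  0<-τ = ≰⇒> λ q → ¬h (lin₁ q (solve 1 (λ t → t :+ :- :0 := :0 :+ :- (:- t)) refl (value τ)))
  flat : ∀ {f : 𝔻 → 𝔻} → (∀ {s} → τ < s → f s ≡ f τ) → SlopeZeroBelow0 f
  -- With δ = -τ the interval (-δ , 0] is exactly the stretch (τ , 0] above the temperature.
  flat above = - τ , 0<-τ , λ s p _ → trans (above (subst (_< s) (-‿involutive τ) p)) (sym (above τ<0))

flat-cong : ∀ {A B : Set} {f : 𝔻 → A} {g : 𝔻 → B} →
  (∀ s → s ≤ 0𝔻 → f s ≡ f 0𝔻 → g s ≡ g 0𝔻) → SlopeZeroBelow0 f → SlopeZeroBelow0 g
flat-cong e (δ , 0<δ , h) = δ , 0<δ , λ s p q → e s q (h s p q)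

module _ {G : Game} {n : ℤ} (¬G : ¬ IsInteger G) where
  private
    eτ = proj₁ (proj₂ (noninteger-temperature ¬G))

  -- The integral stop forces a temperature of at least 0, so ρ̃ₛ and ρₛ agree for all s ≤ 0.
  -- Flatness of ρₛ below 0 then means that its values at -1 and 0 are equal.
  ρ̃-flat : ρₜ 0𝔻 G ≡ fromℤ n → SlopeZeroBelow0 (λ s → ρ̃ₜ s G) ⟺ (⌊ G ⌋ ≡ n)
  ρ̃-flat e =
      (λ flat → ρ-flat G e (flat-cong (λ s p h → [_]-injective (trans (ρ≡ρ̃ p) (trans h (sym (ρ≡ρ̃ ≤-refl))))) flat))
    , (λ eq → flat-cong (λ s p h → trans (sym (ρ≡ρ̃ p)) (trans (cong [_] h) (ρ≡ρ̃ ≤-refl))) (ρ-flat⁻¹ G e eq))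
    where
    ρ≡ρ̃ : ∀ {s} → s ≤ 0𝔻 → [ ρₜ s G ] ≡ ρ̃ₜ s G
    ρ≡ρ̃ p = below-ρ eτ (≤-trans p (integral-stop⇒0≤temperature {n = n} ¬G eτ (inj₂ e)))

  λ̃-flat : λₜ 0𝔻 G ≡ fromℤ n → SlopeZeroBelow0 (λ s → λ̃ₜ s G) ⟺ (⌈ G ⌉ ≡ n)
  λ̃-flat e =
      (λ flat → λ-flat G e (flat-cong (λ s p h → [_]-injective (trans (λ≡λ̃ p) (trans h (sym (λ≡λ̃ ≤-refl))))) flat))
    , (λ eq → flat-cong (λ s p h → trans (sym (λ≡λ̃ p)) (trans (cong [_] h) (λ≡λ̃ ≤-refl))) (λ-flat⁻¹ G e eq))
    where
    λ≡λ̃ : ∀ {s} → s ≤ 0𝔻 → [ λₜ s G ] ≡ λ̃ₜ s G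
    λ≡λ̃ p = below-λ eτ (≤-trans p (integral-stop⇒0≤temperature {n = n} ¬G eτ (inj₁ e)))

-- This unites (i) and (ii): an integer option is its own floor and stop, and for any other option
-- flatness amounts to ⌊ Gᴸ ⌋ = ρ₀(Gᴸ) by `ρ̃-flat`.
raises : ∀ G i → (EqualsM G i ⊎ StopsFlatAtM G i) ⟺ (M G ≡ [ fromℤ ⌊ left G i ⌋ ] × ρₜ 0𝔻 (left G i) ≡ fromℤ ⌊ left G i ⌋)
raises G i = to , from
  where
  to : EqualsM G i ⊎ StopsFlatAtM G i → M G ≡ [ fromℤ ⌊ left G i ⌋ ] × ρₜ 0𝔻 (left G i) ≡ fromℤ ⌊ left G i ⌋
  to (inj₁ (n , eM , e)) = subst (λ k → M G ≡ [ fromℤ k ] × ρₜ 0𝔻 (left G i) ≡ fromℤ k) (sym (⌊⌋-integer {left G i} {n} e))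
    (eM , integer-ρ {left G i} {n} 0𝔻 e)
  to (inj₂ (n , eM , eρ , ¬int , flat)) = subst (λ k → M G ≡ [ fromℤ k ] × ρₜ 0𝔻 (left G i) ≡ fromℤ k)
    (sym (proj₁ (ρ̃-flat {left G i} {n} ¬int eρ) flat)) (eM , eρ)
  from : M G ≡ [ fromℤ ⌊ left G i ⌋ ] × ρₜ 0𝔻 (left G i) ≡ fromℤ ⌊ left G i ⌋ → EqualsM G i ⊎ StopsFlatAtM G i
  from (eM , eρ) with IsInteger? (left G i)
  ... | yes (n , e) = inj₁ (n , trans eM (cong (λ k → [ fromℤ k ]) (⌊⌋-integer {left G i} {n} e)) , e)
  ... | no ¬int = inj₂ (⌊ left G i ⌋ , eM , eρ , ¬int , proj₂ (ρ̃-flat {left G i} {⌊ left G i ⌋} ¬int eρ) refl)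

-- Mirror image of `raises` for (iii) and (iv), with `λ̃-flat` in place of `ρ̃-flat`.
lowers : ∀ G j → (Equalsm G j ⊎ StopsFlatAtm G j) ⟺ (m G ≡ [ fromℤ ⌈ right G j ⌉ ] × λₜ 0𝔻 (right G j) ≡ fromℤ ⌈ right G j ⌉)
lowers G j = to , from
  where
  to : Equalsm G j ⊎ StopsFlatAtm G j → m G ≡ [ fromℤ ⌈ right G j ⌉ ] × λₜ 0𝔻 (right G j) ≡ fromℤ ⌈ right G j ⌉
  to (inj₁ (n , em , e)) = subst (λ k → m G ≡ [ fromℤ k ] × λₜ 0𝔻 (right G j) ≡ fromℤ k) (sym (⌈⌉-integer {right G j} {n} e))
    (em , integer-λ {right G j} {n} 0𝔻 e)
  to (inj₂ (n , em , eλ , ¬int , flat)) = subst (λ k → m G ≡ [ fromℤ k ] × λₜ 0𝔻 (right G j) ≡ fromℤ k)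
    (sym (proj₁ (λ̃-flat {right G j} {n} ¬int eλ) flat)) (em , eλ)
  from : m G ≡ [ fromℤ ⌈ right G j ⌉ ] × λₜ 0𝔻 (right G j) ≡ fromℤ ⌈ right G j ⌉ → Equalsm G j ⊎ StopsFlatAtm G j
  from (em , eλ) with IsInteger? (right G j)
  ... | yes (n , e) = inj₁ (n , trans em (cong (λ k → [ fromℤ k ]) (⌈⌉-integer {right G j} {n} e)) , e)
  ... | no ¬int = inj₂ (⌈ right G j ⌉ , em , eλ , ¬int , proj₂ (λ̃-flat {right G j} {⌈ right G j ⌉} ¬int eλ) refl)

-- The bounds `l` and `r` in terms of floors and ceilings

if-does : ∀ {P A : Set} (P? : Dec P) (x y : A) →
  (P × (if does P? then x else y) ≡ x) ⊎ (¬ P × (if does P? then x else y) ≡ y)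
if-does (yes p) x y = inj₁ (p , refl)
if-does (no ¬p) x y = inj₂ (¬p , refl)

l≤ : ∀ G n → (l G ≤± [ fromℤ n ]) ⟺ (∀ i → ⌊ left G i ⌋ ℤ.< n)
-- Each case carries both the truth of the condition and the resulting value of `l G`.
l≤ G n = to (if-does (any? (raises? G)) _ _) , from (if-does (any? (raises? G)) _ _)
  where
  v = λ i → ρₜ 0𝔻 (left G i)
  Raised = ∃ λ i → EqualsM G i ⊎ StopsFlatAtM G i
  Cases = (Raised × l G ≡ M G +± fromℤ 1ℤ) ⊎ (¬ Raised × l G ≡ M G)
  to : Cases → l G ≤± [ fromℤ n ] → ∀ i → ⌊ left G i ⌋ ℤ.< n
  to (inj₁ (_ , el)) h i with max-upper v i
  ... | x , eM , v≤x = ℤ.suc[i]≤j⇒i<j (fromℤ-cancel (≤-trans (≤-reflexive (sym (fromℤ-shift 1ℤ ⌊ left G i ⌋)))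
      (≤-trans (+-monoˡ-≤ (fromℤ 1ℤ) (≤-trans (⌊⌋≤ρ₀ (left G i)) v≤x)) x+1≤n)))
    where
    x+1≤n : x + fromℤ 1ℤ ≤ fromℤ n
    x+1≤n = [≤]-injective (subst (_≤± [ fromℤ n ]) (trans el (cong (_+± fromℤ 1ℤ) eM)) h)
  to (inj₂ (¬raised , el)) h i with max-upper v i
  -- If ⌊ Gᴸ ⌋ = n, then ⌊ Gᴸ ⌋ ≤ ρ₀(Gᴸ) ≤ M ≤ n are all equalities, and `raises` contradicts
  -- `¬raised`.
  ... | x , eM , v≤x = ℤ.≤∧≢⇒< (fromℤ-cancel (≤-trans (⌊⌋≤ρ₀ (left G i)) v≤n)) λ { refl →
      ¬raised (i , proj₂ (raises G i) (trans eM (cong [_] (≤-antisym x≤n (≤-trans (⌊⌋≤ρ₀ (left G i)) v≤x)))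
                                    , ≤-antisym v≤n (⌊⌋≤ρ₀ (left G i)))) }
    where
    x≤n : x ≤ fromℤ n
    x≤n = [≤]-injective (subst (_≤± [ fromℤ n ]) (trans el eM) h)
    v≤n : v i ≤ fromℤ n
    v≤n = ≤-trans v≤x x≤n
  from : Cases → (∀ i → ⌊ left G i ⌋ ℤ.< n) → l G ≤± [ fromℤ n ]
  -- The raising option has ⌊ Gᴸ ⌋ = M, so `h` at this one option already gives M + 1 ≤ n.
  from (inj₁ ((i , raised) , el)) h =
    subst (_≤± [ fromℤ n ]) (sym (trans el (cong (_+± fromℤ 1ℤ) (proj₁ (proj₁ (raises G i) raised)))))
      [ ≤-trans (≤-reflexive (fromℤ-shift 1ℤ ⌊ left G i ⌋)) (grid-mono 0 (ℤ.i<j⇒suc[i]≤j (h i))) ]≤±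
  from (inj₂ (_ , el)) h = subst (_≤± [ fromℤ n ]) (sym el)
    (max-lub v λ i → ≤-trans (ρ₀≤suc⌊⌋ (left G i)) (grid-mono 0 (ℤ.i<j⇒suc[i]≤j (h i))))

-- Mirror image of `l≤`: now ⌈ Gᴿ ⌉ - 1 ≤ λ₀(Gᴿ) ≤ ⌈ Gᴿ ⌉, and the exceptional case is λ₀(Gᴿ) = ⌈ Gᴿ
-- ⌉ = n, where m is lowered.
≤r : ∀ G n → ([ fromℤ n ] ≤± r G) ⟺ (∀ j → n ℤ.< ⌈ right G j ⌉)
≤r G n = to (if-does (any? (lowers? G)) _ _) , from (if-does (any? (lowers? G)) _ _)
  where
  v = λ j → λₜ 0𝔻 (right G j)
  Lowered = ∃ λ j → Equalsm G j ⊎ StopsFlatAtm G j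
  Cases = (Lowered × r G ≡ m G +± fromℤ -1ℤ) ⊎ (¬ Lowered × r G ≡ m G)
  to : Cases → [ fromℤ n ] ≤± r G → ∀ j → n ℤ.< ⌈ right G j ⌉
  to (inj₁ (_ , er)) h j with min-lower v j
  ... | x , em , x≤v = ℤ.i≤pred[j]⇒i<j (fromℤ-cancel (≤-trans n≤x-1
      (≤-trans (+-monoˡ-≤ (fromℤ -1ℤ) (≤-trans x≤v (λ₀≤⌈⌉ (right G j)))) (≤-reflexive (fromℤ-shift -1ℤ ⌈ right G j ⌉)))))
    where
    n≤x-1 : fromℤ n ≤ x + fromℤ -1ℤ
    n≤x-1 = [≤]-injective (subst ([ fromℤ n ] ≤±_) (trans er (cong (_+± fromℤ -1ℤ) em)) h)
  to (inj₂ (¬lowered , er)) h j with min-lower v j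
  ... | x , em , x≤v = ℤ.≤∧≢⇒< (fromℤ-cancel (≤-trans n≤v (λ₀≤⌈⌉ (right G j)))) λ { refl →
      ¬lowered (j , proj₂ (lowers G j) (trans em (cong [_] (≤-antisym (≤-trans x≤v (λ₀≤⌈⌉ (right G j))) n≤x))
                                     , ≤-antisym (λ₀≤⌈⌉ (right G j)) n≤v)) }
    where
    n≤x : fromℤ n ≤ x
    n≤x = [≤]-injective (subst ([ fromℤ n ] ≤±_) (trans er em) h)
    n≤v : fromℤ n ≤ v j
    n≤v = ≤-trans n≤x x≤v
  from : Cases → (∀ j → n ℤ.< ⌈ right G j ⌉) → [ fromℤ n ] ≤± r G
  from (inj₁ ((j , lowered) , er)) h =
    subst ([ fromℤ n ] ≤±_) (sym (trans er (cong (_+± fromℤ -1ℤ) (proj₁ (proj₁ (lowers G j) lowered)))))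
      [ ≤-trans (grid-mono 0 (ℤ.i<j⇒i≤pred[j] (h j))) (≤-reflexive (sym (fromℤ-shift -1ℤ ⌈ right G j ⌉))) ]≤±
  from (inj₂ (_ , er)) h = subst ([ fromℤ n ] ≤±_) (sym er)
    (min-glb v λ j → ≤-trans (grid-mono 0 (ℤ.i<j⇒i≤pred[j] (h j))) (pred⌈⌉≤λ₀ (right G j)))

-- Fitting integers and the least absolute value

S⟺Fits : ∀ G n → S G n ⟺ Fits G n
S⟺Fits G n =
    (λ (p , q) → (λ i h → ℤ.<⇒≱ (proj₁ (l≤ G n) p i) (proj₂ (≤⌊⌋ (left G i) n) h))
               , (λ j h → ℤ.<⇒≱ (proj₁ (≤r G n) q j) (proj₂ (⌈⌉≤ (right G j) n) h)))
  , (λ (p , q) → proj₂ (l≤ G n) (λ i → ℤ.≰⇒> λ h → p i (proj₁ (≤⌊⌋ (left G i) n) h))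
               , proj₂ (≤r G n) (λ j → ℤ.≰⇒> λ h → q j (proj₁ (⌈⌉≤ (right G j) n) h)))

-- As Right has no move in n ≥ 0, k ≤ n and Fits G k would force G ≤ n.
positive-least : ∀ {G n k} → G ≈ᴳ integer (+ suc n) → Fits G k → + suc n ℤ.≤ k
positive-least {G} {n} {k} (n+1≤G , _) (p , _) = ℤ.≮⇒≥ λ k<n+1 →
  integer-< (+ n) (≤ᴳ-trans {integer (+ suc n)} {G} {integer (+ n)} n+1≤G (≤-intro {G} {integer (+ n)}
    (λ i h → p i (≤ᴳ-trans {integer k} {integer (+ n)} (integer-mono (ℤ.i<j⇒i≤pred[j] k<n+1)) h)) (no-right n)))
  where
  no-right : ∀ n j → ¬ right (integer (+ n)) j ≤ᴳ G
  no-right zero ()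
  no-right (suc n) ()

-- Mirror image: Left has no move in `N` ≤ 0, so `N` ≤ k and `Fits G k` would force `N` ≤ G.
negative-greatest : ∀ {G n k} → G ≈ᴳ integer -[1+ n ] → Fits G k → k ℤ.≤ -[1+ n ]
negative-greatest {G} {n} {k} (_ , G≤n) (_ , q) = ℤ.≮⇒≥ λ n<k →
  integer-< -[1+ n ] (≤ᴳ-trans {integer N} {G} {integer -[1+ n ]} (≤-intro {integer N} {G}
    (no-left n) (λ j h → q j (≤ᴳ-trans {right G j} {integer N} h (integer-mono (ℤ.i<j⇒suc[i]≤j n<k))))) G≤n)
  where
  N = ℤ.suc -[1+ n ]
  no-left : ∀ n i → ¬ G ≤ᴳ left (integer (ℤ.suc -[1+ n ])) i
  no-left zero ()
  no-left (suc zero) ()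
  no-left (suc (suc n)) ()

-- Seen from 0, no fitting integer lies before n or on the other side of 0 when n is nonzero; so
-- equal absolute values leave no choice of sign.
simplest : ∀ {G} n {k} → G ≈ᴳ integer n → Fits G k → ℤ.∣ n ∣ ℕ.≤ ℤ.∣ k ∣ × (ℤ.∣ k ∣ ℕ.≤ ℤ.∣ n ∣ → k ≡ n)
simplest (+ zero) e f = ℕ.z≤n , λ h → ℤ.∣i∣≡0⇒i≡0 (ℕ.n≤0⇒n≡0 h)
simplest {G} (+ suc n) {k} e f with positive-least {G} {n} {k} e f
... | ℤ.+≤+ h = h , λ h′ → cong +_ (ℕ.≤-antisym h′ h)
simplest {G} -[1+ n ] {k} e f with negative-greatest {G} {n} {k} e f
... | ℤ.-≤- h = ℕ.s≤s h , λ { (ℕ.s≤s h′) → cong -[1+_] (ℕ.≤-antisym h′ h) }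

theorem20 : (G : Game) →
    (Empty (S G) → ¬ IsInteger G) ×
    (¬ Empty (S G) →
    ∃ λ n → HasLeastAbs (S G) n × (∀ k → HasLeastAbs (S G) k → k ≡ n) × G ≈ᴳ integer n)
theorem20 G = (λ empty (n , e) → empty n (inS n e)) , nonempty
  where
  inS : ∀ n → G ≈ᴳ integer n → S G n
  inS n e = proj₂ (S⟺Fits G n) (fits G n e)
  nonempty : ¬ Empty (S G) →
    ∃ λ n → HasLeastAbs (S G) n × (∀ k → HasLeastAbs (S G) k → k ≡ n) × G ≈ᴳ integer n
  -- `¬empty` supplies no element of `S G`; deciding whether G is an integer produces the witness.
  nonempty ¬empty with IsInteger? G
  ... | no ¬int = contradiction (λ k s → ¬int (simplicity G k (proj₁ (S⟺Fits G k) s))) ¬empty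
  ... | yes (n , e) = n
    , (inS n e , λ k s → proj₁ (simplest {G} n e (proj₁ (S⟺Fits G k) s)))
    , (λ k (s , least) → proj₂ (simplest {G} n e (proj₁ (S⟺Fits G k) s)) (least n (inS n e)))
    , e
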